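{- There is a polynomial $p$ such that the following holds for all $\epsilon,\delta\in(0,1)$ and all $n$. Let $\mu$ be a known distribution over $[n]$ such that $\|\mu-U_n\|_\infty<\frac{\epsilon}{100n}$, where $U_n$ is the uniform distribution over $[n]$. Then identity with $\mu$ can be tested by an adaptive algorithm using at most $p(\epsilon^{ -1},\log(\delta^{ -1}))$ conditional samples: given conditional sample access to an unknown distribution $\mu'$ over $[n]$, the algorithm accepts with probability at least $1-\delta$ if $\mu'=\mu$, and rejects with probability at least $1-\delta$ if $d(\mu,\mu')\ge\epsilon$.
   Context: $[n]=\{1,\ldots,n\}$; $U_n(i)=1/n$; $\|\mu-U_n\|_\infty=\max_i|\mu(i)-1/n|$; the variation distance is $d(\mu,\mu')=\frac12\sum_{i=1}^n|\mu(i)-\mu'(i)|$. A conditional sample from $\mu'$ with a nonempty set $A\subseteq[n]$ is an element $j\in A$ drawn with probability $\mu'(j)/\mu'(A)$ if $\mu'(A)>0$, and uniformly from $A$ if $\mu'(A)=0$, independently of all previous samples. An adaptive algorithm is a randomized algorithm that may choose each conditioning set based on the previously received samples and its internal coin tosses, and finally accepts or rejects based on the received samples and its coin tosses. The algorithm is given $\mu,\epsilon,\delta,n$ explicitly. -}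

module Defs where

open import Algebra.Bundles using (CommutativeRing)
open import Algebra.Core using (Op₁; Op₂)
open import Algebra.Structures using (IsCommutativeRing)
open import Data.Bool.Base using (Bool; true; false; if_then_else_)
open import Data.Fin.Base using (Fin)
open import Data.Fin.Subset using (Subset; Nonempty; ∣_∣)
open import Data.Fin.Subset.Properties using (_∈?_)
open import Data.List.Base as List using (List)
open import Data.Nat.Base as ℕ using (ℕ; suc)
open import Data.Product.Base using (_×_; ∃; ∃-syntax)
open import Data.Vec.Functional as Vector using (Vector)
open import Level using (0ℓ)
open import Relation.Binary.Bundles using (DecTotalOrder; StrictTotalOrder)
open import Relation.Binary.Core using (Rel)
open import Relation.Binary.Structures using (IsDecTotalOrder)
open import Relation.Nullary using (¬_; does)

record OrderedField : Set₁ where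
  infix  8 -_
  infix  9 _⁻¹
  infixl 7 _*_
  infixl 6 _+_
  infix  4 _≈_ _≤_
  field
    Carrier           : Set
    _≈_ _≤_           : Rel Carrier 0ℓ
    _+_ _*_           : Op₂ Carrier
    -_ _⁻¹            : Op₁ Carrier
    0# 1#             : Carrier
    isCommutativeRing : IsCommutativeRing _≈_ _+_ _*_ -_ 0# 1#
    isDecTotalOrder   : IsDecTotalOrder _≈_ _≤_
    0≉1               : ¬ (0# ≈ 1#)
    ⁻¹-inverse        : ∀ x → ¬ (x ≈ 0#) → x * x ⁻¹ ≈ 1#
    +-monoˡ-≤         : ∀ x y z → x ≤ y → x + z ≤ y + z
    *-nonneg          : ∀ x y → 0# ≤ x → 0# ≤ y → 0# ≤ x * y

  commutativeRing : CommutativeRing 0ℓ 0ℓ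
  commutativeRing = record { isCommutativeRing = isCommutativeRing }

  decTotalOrder : DecTotalOrder 0ℓ 0ℓ 0ℓ
  decTotalOrder = record { isDecTotalOrder = isDecTotalOrder }

  open CommutativeRing commutativeRing using (+-rawMonoid)
  open import Algebra.Definitions.RawMonoid +-rawMonoid
    using () renaming (_×_ to _·_)

  fromℕ : ℕ → Carrier
  fromℕ k = k · 1#

  UpperBound : (Carrier → Set) → Carrier → Set
  UpperBound P b = ∀ x → P x → x ≤ b

  IsSupremum : (Carrier → Set) → Carrier → Set
  IsSupremum P s = UpperBound P s × (∀ b → UpperBound P b → s ≤ b)

-- The real numbers, with their classical theory, as a complete ordered field
-- (unique up to isomorphism).  Inverses and suprema are total functions,
-- constrained only on nonzero elements and on inhabited, bounded above
-- subsets respectively.  The Archimedean property classically follows from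
-- the existence of suprema; it is an axiom because intuitionistically the
-- existence of suprema does not produce the natural number.

record CompleteOrderedField : Set₁ where
  field
    orderedField : OrderedField

  open OrderedField orderedField public

  field
    sup            : (Carrier → Set) → Carrier
    sup-isSupremum : ∀ P → ∃ P → ∃ (UpperBound P) → IsSupremum P (sup P)
    archimedean    : ∀ x → ∃[ k ] x ≤ fromℕ k

data Verdict : Set where
  accept reject : Verdict

-- Adaptive randomized algorithms over [n] drawing at most q conditional
-- samples, as decision trees: each toss is of a fair coin, and each
-- conditioning set may depend on everything seen on the way to it.

data Algorithm (n : ℕ) : ℕ → Set where
  halt   : ∀ {q} → Verdict → Algorithm n q
  toss   : ∀ {q} → (Bool → Algorithm n q) → Algorithm n q
  sample : ∀ {q} (A : Subset n) → Nonempty A →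
           (Fin n → Algorithm n q) → Algorithm n (suc q)

module Testing (R : CompleteOrderedField) where

  open CompleteOrderedField R public renaming (Carrier to ℝ)
  open CommutativeRing commutativeRing public
    using (_-_; +-rawMonoid; semiring)
  open DecTotalOrder decTotalOrder public using (totalOrder)
  open import Relation.Binary.Properties.DecTotalOrder decTotalOrder public
    using (_<_; <-strictTotalOrder)
  open StrictTotalOrder <-strictTotalOrder public using (_<?_)
  open import Algebra.Construct.NaturalChoice.Max totalOrder public
    using (_⊔_)
  open import Algebra.Definitions.RawMonoid +-rawMonoid public using (sum)
  open import Algebra.Properties.Semiring.Exp semiring public using (_^_)

  infixl 7 _÷_

  _÷_ : Op₂ ℝ
  x ÷ y = x * y ⁻¹

  ∣_∣ᵣ : Op₁ ℝ
  ∣ x ∣ᵣ = x ⊔ (- x)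

  -- log₂ x = sup { r ∈ ℚ, r ≥ 0 : 2 ^ r ≤ x } for x ≥ 1 (junk for x < 1),
  -- where 2 ^ (a / b) ≤ x is expressed as 2 ^ a ≤ x ^ b.
  log₂ : Op₁ ℝ
  log₂ x = sup λ r → ∃[ a ] ∃[ b ]
    1 ℕ.≤ b × r ≈ fromℕ a ÷ fromℕ b × fromℕ 2 ^ a ≤ x ^ b

  -- The entry a i j of [[a 0 0, a 0 1, …], [a 1 0, …], …] is the coefficient
  -- of X ^ i * Y ^ j.
  Polynomial₂ : Set
  Polynomial₂ = List (List ℝ)

  eval₂ : Polynomial₂ → ℝ → ℝ → ℝ
  eval₂ p x y = horner x (List.map (horner y) p)
    where
    horner : ℝ → List ℝ → ℝ
    horner z = List.foldr (λ c r → c + z * r) 0#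

  record Distribution (n : ℕ) : Set where
    field
      prob   : Vector ℝ n
      nonneg : ∀ i → 0# ≤ prob i
      total  : sum prob ≈ 1#

  open Distribution public

  infix 4 _≋_
  _≋_ : ∀ {n} → Distribution n → Distribution n → Set
  μ ≋ ν = ∀ i → prob μ i ≈ prob ν i

  uniform : ∀ n → Vector ℝ n
  uniform n i = fromℕ n ⁻¹

  ‖_-_‖∞ : ∀ {n} → Vector ℝ n → Vector ℝ n → ℝ
  ‖ f - g ‖∞ = Vector.foldr _⊔_ 0# λ i → ∣ f i - g i ∣ᵣ

  variationDistance : ∀ {n} → Distribution n → Distribution n → ℝ
  variationDistance μ ν = fromℕ 2 ⁻¹ * sum λ i → ∣ prob μ i - prob ν i ∣ᵣ

  mass : ∀ {n} → Distribution n → Subset n → ℝ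
  mass μ A = sum λ i → if does (i ∈? A) then prob μ i else 0#

  -- The probability that a conditional sample from μ with the set A is j.
  sampleProb : ∀ {n} → Distribution n → Subset n → Fin n → ℝ
  sampleProb μ A j =
    if does (j ∈? A)
    then (if does (0# <? mass μ A) then prob μ j ÷ mass μ A else fromℕ ∣ A ∣ ⁻¹)
    else 0#

  -- Pr v T μ is the probability that T, sampling from μ, halts with v.
  Pr : ∀ {n q} → Verdict → Algorithm n q → Distribution n → ℝ
  Pr v (halt w)       μ = indicator v w
    where
    indicator : Verdict → Verdict → ℝ
    indicator accept accept = 1#
    indicator reject reject = 1#
    indicator _      _      = 0#
  Pr v (toss T)       μ = fromℕ 2 ⁻¹ * (Pr v (T true) μ + Pr v (T false) μ)
  Pr v (sample A _ T) μ = sum λ j → sampleProb μ A j * Pr v (T j) μ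

  TestsIdentity : ∀ {n q} → ℝ → ℝ → Distribution n → Algorithm n q → Set
  TestsIdentity {n} ε δ μ T = ∀ (μ′ : Distribution n) →
    (μ′ ≋ μ → 1# - δ ≤ Pr accept T μ′) ×
    (ε ≤ variationDistance μ μ′ → 1# - δ ≤ Pr reject T μ′)

{-# OPTIONS --safe #-}
module Submission where

-- Write P(j | i, j) for the probability that a sample conditioned on {i, j} is
-- j.  One trial draws i by coin tosses that give every element weight at least
-- 1 / 2n, then j from the unknown distribution ν, then x and y from ν
-- conditioned on {i, j}.  Let b be P(j | i, j) under ν minus P(j | i, j) under
-- the known μ.  Given i and j, the deviations [x = j] - P(j | i, j) and
-- [y = j] - P(j | i, j), with P taken under μ, are independent with mean b, so
-- their product z lies in [-1, 1] and has mean b².  The score of ν is the mean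
-- of z.  It is zero if ν = μ (score-null), and at least ε² / 40 if
-- d(μ, ν) ≥ ε (score-far).
--
-- For the lower bound let p be the probabilities of ν.  Since μ is nearly
-- uniform, P(j | i, j) under μ is at most 1/2 + ε/100 for i ≠ j, and
-- p_j (p_j / (p_i + p_j) - 1/2) ≥ (p_j - p_i) / 4 whichever of the two is
-- larger (bias-bound).  Summing over j shows that, given i, the mean of b is at
-- least (1 - n p_i) / 4 - ε/100.  The tangent line b² ≥ (ε/2) b - ε²/16 turns
-- this into a bound on the mean of b² given i (pairScore-bound).  That mean is
-- also nonnegative, so the positive part of μ_i - p_i may be used in the bound
-- (pairScore-gain), and the sum of these positive parts is d(μ, ν).
--
-- The trials are combined by betting rather than by averaging.  A gambler
-- starts with wealth 1, and every trial multiplies the wealth by 1 + s z, where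
-- s = ε² / 160; the algorithm rejects when the final wealth is at least 1/δ.
-- If ν = μ the wealth is a martingale, so by Markov's inequality it ends at
-- 1/δ or above with probability at most δ (Pr-reject-null).  If ν is far, the
-- mean of the reciprocal of the wealth shrinks by the factor 1 - 2s² in every
-- trial; once it is at most δ², Markov's inequality shows that the wealth ends
-- below 1/δ with probability at most δ (Pr-accept-far).  By Bernoulli's
-- inequality (trials-suffice) this takes a number of trials of order
-- ε⁻⁴ (log(1/δ) + 1), each of three samples.

open import Defs
open import Data.Nat.Base using (ℕ)
open import Data.Product.Base using (_×_; Σ-syntax; ∃-syntax)

open import Algebra.Bundles using (CommutativeRing)
open import Data.Bool.Base using (Bool; true; false; if_then_else_)
open import Data.Empty using (⊥-elim)
open import Data.Fin.Base using (Fin; zero; suc; _↑ˡ_; _↑ʳ_)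
open import Data.Fin.Properties using (_≟_)
open import Data.Fin.Subset using (Subset; inside; outside; Nonempty; ∣_∣; ⊤; ⁅_⁆; _∪_; _∈_)
open import Data.Fin.Subset.Properties
  using (_∈?_; ∈⊤; x∈⁅x⁆; x∈⁅y⁆⇒x≡y; x∈p∪q⁻; x∈p∪q⁺)
open import Data.Integer.Base as ℤ using (ℤ; +_; -[1+_]; _⊖_; +0; +[1+_])
import Data.Integer.Properties as ℤ
open import Data.List.Base using ([]; _∷_)
open import Data.Maybe.Base using (Maybe; just; nothing)
open import Data.Nat.Base as ℕ using (zero; suc; z≤n; s≤s)
import Data.Nat.Properties as ℕ
open import Data.Product.Base using (_,_; proj₁; proj₂)
open import Data.Sum.Base using (inj₁; inj₂)
open import Data.Vec.Base using ([]; _∷_; there)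
open import Data.Vec.Functional using (Vector)
open import Level using (0ℓ)
open import Relation.Binary.Bundles using (DecTotalOrder)
open import Relation.Binary.PropositionalEquality as ≡ using (_≡_; _≢_)
open import Relation.Nullary using (¬_; yes; no; does)
open import Relation.Nullary.Decidable using (dec-true; dec-false)

-- Integer coefficients for ring identities

-- Ring identities are decided with integer coefficients, the numeral k being
-- read as k · 1#.
module IntegerSolver (R : CommutativeRing 0ℓ 0ℓ) where
  open CommutativeRing R
  open import Algebra.Definitions.RawMonoid +-rawMonoid using () renaming (_×_ to _·_)
  open import Algebra.Properties.Monoid.Mult +-monoid using (×-homo-+)
  open import Algebra.Properties.Semiring.Mult semiring using (×1-homo-*)
  open import Algebra.Properties.Ring ring
    using (-‿distribˡ-*; -‿distribʳ-*)
  open import Algebra.Properties.AbelianGroup +-abelianGroup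
    using (ε⁻¹≈ε; ⁻¹-involutive; ⁻¹-∙-comm)
  open import Algebra.Properties.CommutativeSemigroup
    (CommutativeRing.+-commutativeSemigroup R) using (interchange)
  open import Algebra.Solver.Ring.AlmostCommutativeRing
    using (AlmostCommutativeRing; fromCommutativeRing; _-Raw-AlmostCommutative⟶_)
  open import Relation.Binary.Reasoning.Setoid setoid

  ⟦_⟧ : ℤ → Carrier
  ⟦ + n ⟧      = n · 1#
  ⟦ -[1+ n ] ⟧ = - (suc n · 1#)

  ⟦⊖⟧ : ∀ m n → ⟦ m ⊖ n ⟧ ≈ m · 1# - n · 1#
  ⟦⊖⟧ m zero = sym (trans (+-congˡ ε⁻¹≈ε) (+-identityʳ _))
  ⟦⊖⟧ zero (suc n) = sym (+-identityˡ _)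
  ⟦⊖⟧ (suc m) (suc n) = begin
    ⟦ suc m ⊖ suc n ⟧                   ≡⟨ ≡.cong ⟦_⟧ (ℤ.[1+m]⊖[1+n]≡m⊖n m n) ⟩
    ⟦ m ⊖ n ⟧                           ≈⟨ ⟦⊖⟧ m n ⟩
    m · 1# - n · 1#                     ≈⟨ +-identityˡ _ ⟨
    0# + (m · 1# - n · 1#)              ≈⟨ +-congʳ (-‿inverseʳ 1#) ⟨
    (1# - 1#) + (m · 1# - n · 1#)       ≈⟨ interchange 1# (- 1#) (m · 1#) (- (n · 1#)) ⟩
    (suc m · 1#) + (- 1# - n · 1#)      ≈⟨ +-congˡ (⁻¹-∙-comm 1# (n · 1#)) ⟩
    (suc m · 1#) - (suc n · 1#)         ∎

  ⟦⟧-+ : ∀ i j → ⟦ i ℤ.+ j ⟧ ≈ ⟦ i ⟧ + ⟦ j ⟧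
  ⟦⟧-+ (+ m) (+ n) = ×-homo-+ 1# m n
  ⟦⟧-+ (+ m) -[1+ n ] = ⟦⊖⟧ m (suc n)
  ⟦⟧-+ -[1+ m ] (+ n) = trans (⟦⊖⟧ n (suc m)) (+-comm _ _)
  ⟦⟧-+ -[1+ m ] -[1+ n ] = begin
    - (suc (suc (m ℕ.+ n)) · 1#)         ≡⟨ ≡.cong (λ k → - (suc k · 1#)) (ℕ.+-suc m n) ⟨
    - ((suc m ℕ.+ suc n) · 1#)           ≈⟨ -‿cong (×-homo-+ 1# (suc m) (suc n)) ⟩
    - (suc m · 1# + suc n · 1#)          ≈⟨ ⁻¹-∙-comm _ _ ⟨
    - (suc m · 1#) - (suc n · 1#)        ∎

  ⟦⟧-neg : ∀ i → ⟦ ℤ.- i ⟧ ≈ - ⟦ i ⟧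
  ⟦⟧-neg +0       = sym ε⁻¹≈ε
  ⟦⟧-neg +[1+ n ] = refl
  ⟦⟧-neg -[1+ n ] = sym (⁻¹-involutive _)

  ⟦⟧-+* : ∀ m j → ⟦ + m ℤ.* j ⟧ ≈ ⟦ + m ⟧ * ⟦ j ⟧
  ⟦⟧-+* m (+ n) = begin
    ⟦ + m ℤ.* + n ⟧   ≡⟨ ≡.cong ⟦_⟧ (ℤ.pos-* m n) ⟨
    (m ℕ.* n) · 1#    ≈⟨ ×1-homo-* m n ⟩
    ⟦ + m ⟧ * ⟦ + n ⟧ ∎
  ⟦⟧-+* m -[1+ n ] = begin
    ⟦ + m ℤ.* -[1+ n ] ⟧          ≡⟨ ≡.cong ⟦_⟧ (ℤ.neg-distribʳ-* (+ m) (+ suc n)) ⟨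
    ⟦ ℤ.- (+ m ℤ.* + suc n) ⟧     ≈⟨ ⟦⟧-neg (+ m ℤ.* + suc n) ⟩
    - ⟦ + m ℤ.* + suc n ⟧         ≈⟨ -‿cong (⟦⟧-+* m (+ suc n)) ⟩
    - (⟦ + m ⟧ * ⟦ + suc n ⟧)     ≈⟨ -‿distribʳ-* _ _ ⟩
    ⟦ + m ⟧ * ⟦ -[1+ n ] ⟧        ∎

  ⟦⟧-* : ∀ i j → ⟦ i ℤ.* j ⟧ ≈ ⟦ i ⟧ * ⟦ j ⟧
  ⟦⟧-* (+ m) j = ⟦⟧-+* m j
  ⟦⟧-* -[1+ m ] j = begin
    ⟦ -[1+ m ] ℤ.* j ⟧          ≡⟨ ≡.cong ⟦_⟧ (ℤ.neg-distribˡ-* (+ suc m) j) ⟨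
    ⟦ ℤ.- (+ suc m ℤ.* j) ⟧     ≈⟨ ⟦⟧-neg (+ suc m ℤ.* j) ⟩
    - ⟦ + suc m ℤ.* j ⟧         ≈⟨ -‿cong (⟦⟧-+* (suc m) j) ⟩
    - (⟦ + suc m ⟧ * ⟦ j ⟧)     ≈⟨ -‿distribˡ-* _ _ ⟩
    ⟦ -[1+ m ] ⟧ * ⟦ j ⟧        ∎

  -- The coefficient 1 is sent to 1# itself, not to 1# + 0#, so that both 1#
  -- and the numerals from 2 on can be written as constants.
  coefficient : ℤ → Carrier
  coefficient (+ 1) = 1#
  coefficient i     = ⟦ i ⟧

  coefficient≈⟦⟧ : ∀ i → coefficient i ≈ ⟦ i ⟧
  coefficient≈⟦⟧ +0             = refl
  coefficient≈⟦⟧ (+ 1)          = sym (+-identityʳ 1#)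
  coefficient≈⟦⟧ +[1+ suc n ]   = refl
  coefficient≈⟦⟧ -[1+ n ]       = refl

  almostCommutativeRing : AlmostCommutativeRing 0ℓ 0ℓ
  almostCommutativeRing = fromCommutativeRing R

  coefficientMorphism : ℤ.+-*-rawRing -Raw-AlmostCommutative⟶ almostCommutativeRing
  coefficientMorphism = record
    { ⟦_⟧    = coefficient
    ; +-homo = λ i j → trans (coefficient≈⟦⟧ (i ℤ.+ j)) (trans (⟦⟧-+ i j)
                 (sym (+-cong (coefficient≈⟦⟧ i) (coefficient≈⟦⟧ j))))
    ; *-homo = λ i j → trans (coefficient≈⟦⟧ (i ℤ.* j)) (trans (⟦⟧-* i j)
                 (sym (*-cong (coefficient≈⟦⟧ i) (coefficient≈⟦⟧ j))))
    ; -‿homo = λ i → trans (coefficient≈⟦⟧ (ℤ.- i)) (trans (⟦⟧-neg i)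
                 (sym (-‿cong (coefficient≈⟦⟧ i))))
    ; 0-homo = refl
    ; 1-homo = refl
    }

  equalCoefficients? : ∀ i j → Maybe (coefficient i ≈ coefficient j)
  equalCoefficients? i j with i ℤ.≟ j
  ... | yes i≡j = just (reflexive (≡.cong coefficient i≡j))
  ... | no  _   = nothing

  open import Algebra.Solver.Ring
    ℤ.+-*-rawRing almostCommutativeRing coefficientMorphism equalCoefficients? public
    using (solve; con; _:=_; _:+_; _:*_; _:-_; :-_)

module IdentityTesting (R : CompleteOrderedField) where

  open Testing R
  open CommutativeRing commutativeRing
    using ( refl; sym; trans; reflexive; +-cong; +-congˡ; +-congʳ; *-cong; *-congˡ; *-congʳ
          ; *-comm; +-identityˡ; +-identityʳ; *-identityˡ; *-identityʳ; -‿inverseʳ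
          ; zeroˡ; zeroʳ; *-assoc; distribˡ; +-monoid; +-commutativeMonoid )
  open DecTotalOrder decTotalOrder
    using (poset; _≤?_)
    renaming ( refl to ≤-refl; trans to ≤-trans; reflexive to ≤-reflexive
             ; total to ≤-total; antisym to ≤-antisym )
  open import Relation.Binary.Properties.DecTotalOrder decTotalOrder using (≮⇒≥; ≰⇒≥)
  open import Algebra.Construct.NaturalChoice.Max totalOrder using (x≤x⊔y; x≤y⊔x; ⊔-sel)
  open import Algebra.Properties.Monoid.Mult +-monoid using (×-homo-+)
  open import Algebra.Properties.Semiring.Mult semiring using () renaming (×1-homo-* to fromℕ-*)
  open import Algebra.Properties.Semiring.Exp semiring using (^-homo-*; ^-assocʳ)
  open import Algebra.Properties.Monoid.Sum +-monoid using () renaming (sum-cong-≋ to sum-cong)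
  open import Algebra.Properties.CommutativeMonoid.Sum +-commutativeMonoid
    using () renaming (∑-distrib-+ to sum-+)
  open import Algebra.Properties.Semiring.Sum semiring using (*-distribˡ-sum)
  open import Relation.Binary.Reasoning.PartialOrder poset
  open IntegerSolver commutativeRing using (solve; con; _:=_; _:+_; _:*_; _:-_; :-_)

  -- Ordered field arithmetic

  ≤-resp : ∀ {x x′ y y′} → x ≈ x′ → y ≈ y′ → x ≤ y → x′ ≤ y′
  ≤-resp x≈x′ y≈y′ x≤y = ≤-trans (≤-reflexive (sym x≈x′)) (≤-trans x≤y (≤-reflexive y≈y′))

  -- Nearly every inequality below is proved by exhibiting the difference of its
  -- sides as a sum of products of nonnegative terms; gap turns hypotheses into
  -- such terms and certify reads the conclusion off.
  gap : ∀ {x y} → x ≤ y → 0# ≤ y - x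
  gap {x} {y} x≤y = ≤-resp (-‿inverseʳ x) refl (+-monoˡ-≤ x y (- x) x≤y)

  certify : ∀ {x y c} → y - x ≈ c → 0# ≤ c → x ≤ y
  certify {x} {y} y-x≈c 0≤c = ≤-resp (+-identityˡ x)
    (trans (+-congʳ (sym y-x≈c)) (solve 2 (λ x y → (y :- x) :+ x := y) refl x y))
    (+-monoˡ-≤ _ _ x 0≤c)

  infixl 6 _⟨+⟩_
  infixl 7 _⟨*⟩_

  _⟨+⟩_ : ∀ {x y} → 0# ≤ x → 0# ≤ y → 0# ≤ x + y
  _⟨+⟩_ {x} {y} 0≤x 0≤y = ≤-trans 0≤y (≤-resp (+-identityˡ y) refl (+-monoˡ-≤ 0# x y 0≤x))

  _⟨*⟩_ : ∀ {x y} → 0# ≤ x → 0# ≤ y → 0# ≤ x * y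
  0≤x ⟨*⟩ 0≤y = *-nonneg _ _ 0≤x 0≤y

  -- Equations enter a certificate as products with a vanishing difference.
  vanish : ∀ m {x y} → x ≈ y → 0# ≤ m * (x - y)
  vanish m {x} {y} x≈y = ≤-reflexive (sym (trans
    (*-congˡ (trans (+-congʳ x≈y) (-‿inverseʳ y))) (zeroʳ m)))

  square : ∀ x → 0# ≤ x * x
  square x with ≤-total 0# x
  ... | inj₁ 0≤x = 0≤x ⟨*⟩ 0≤x
  ... | inj₂ x≤0 = ≤-resp refl (solve 1 (λ x → (con (+ 0) :- x) :* (con (+ 0) :- x) := x :* x) refl x)
                     (gap x≤0 ⟨*⟩ gap x≤0)

  0≤1 : 0# ≤ 1#
  0≤1 = ≤-resp refl (*-identityˡ 1#) (square 1#)

  0≤fromℕ : ∀ k → 0# ≤ fromℕ k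
  0≤fromℕ zero    = ≤-refl
  0≤fromℕ (suc k) = 0≤1 ⟨+⟩ 0≤fromℕ k

  fromℕ-mono : ∀ {k l} → k ℕ.≤ l → fromℕ k ≤ fromℕ l
  fromℕ-mono {l = l} z≤n = 0≤fromℕ l
  fromℕ-mono (s≤s {k} {l} k≤l) =
    certify (solve 3 (λ x y z → (z :+ y) :- (z :+ x) := y :- x) refl (fromℕ k) (fromℕ l) 1#)
            (gap (fromℕ-mono k≤l))

  fromℕ-+ : ∀ k l → fromℕ (k ℕ.+ l) ≈ fromℕ k + fromℕ l
  fromℕ-+ = ×-homo-+ 1#

  fromℕ-^ : ∀ k l → fromℕ (k ℕ.^ l) ≈ fromℕ k ^ l
  fromℕ-^ k zero    = +-identityʳ 1#
  fromℕ-^ k (suc l) = trans (fromℕ-* k (k ℕ.^ l)) (*-congˡ (fromℕ-^ k l))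

  1≤fromℕ : ∀ {k} → 1 ℕ.≤ k → 1# ≤ fromℕ k
  1≤fromℕ {k} 1≤k = ≤-trans (≤-reflexive (sym (+-identityʳ 1#))) (fromℕ-mono 1≤k)

  1≤⇒≉0 : ∀ {x} → 1# ≤ x → ¬ x ≈ 0#
  1≤⇒≉0 1≤x x≈0 = 0≉1 (≤-antisym 0≤1 (≤-resp refl x≈0 1≤x))

  fromℕ≉0 : ∀ k → ¬ fromℕ (suc k) ≈ 0#
  fromℕ≉0 k = 1≤⇒≉0 (1≤fromℕ {suc k} (s≤s z≤n))

  0<⇒≉0 : ∀ {x} → 0# < x → ¬ x ≈ 0#
  0<⇒≉0 (_ , 0≉x) x≈0 = 0≉x (sym x≈0)

  ≉0⇒0< : ∀ {x} → 0# ≤ x → ¬ x ≈ 0# → 0# < x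
  ≉0⇒0< 0≤x x≉0 = 0≤x , λ 0≈x → x≉0 (sym 0≈x)

  0<fromℕ : ∀ k → 0# < fromℕ (suc k)
  0<fromℕ k = ≉0⇒0< (0≤fromℕ (suc k)) (fromℕ≉0 k)

  1≤⇒0< : ∀ {x} → 1# ≤ x → 0# < x
  1≤⇒0< 1≤x = ≉0⇒0< (≤-trans 0≤1 1≤x) (1≤⇒≉0 1≤x)

  inverseʳ : ∀ {x} → 0# < x → x * x ⁻¹ ≈ 1#
  inverseʳ 0<x = ⁻¹-inverse _ (0<⇒≉0 0<x)

  0≤⁻¹ : ∀ {x} → 0# < x → 0# ≤ x ⁻¹
  0≤⁻¹ {x} 0<x = certify
    (solve 2 (λ x y → y :- con (+ 0) := x :* (y :* y) :+ (:- y) :* (x :* y :- con (+ 1))) refl x (x ⁻¹))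
    (proj₁ 0<x ⟨*⟩ square (x ⁻¹) ⟨+⟩ vanish (- (x ⁻¹)) (inverseʳ 0<x))

  *-cancelˡ-≤ : ∀ {c x y} → 0# < c → c * x ≤ c * y → x ≤ y
  *-cancelˡ-≤ {c} {x} {y} 0<c cx≤cy = certify
    (solve 4 (λ c d x y → y :- x :=
      d :* (c :* y :- c :* x) :+ (x :- y) :* (c :* d :- con (+ 1))) refl c (c ⁻¹) x y)
    (0≤⁻¹ 0<c ⟨*⟩ gap cx≤cy ⟨+⟩ vanish (x - y) (inverseʳ 0<c))

  *-cancelˡ-≈ : ∀ {c x y} → 0# < c → c * x ≈ c * y → x ≈ y
  *-cancelˡ-≈ 0<c cx≈cy = ≤-antisym (*-cancelˡ-≤ 0<c (≤-reflexive cx≈cy))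
                                    (*-cancelˡ-≤ 0<c (≤-reflexive (sym cx≈cy)))

  *-monoˡ-≤ : ∀ {c x y} → 0# ≤ c → x ≤ y → c * x ≤ c * y
  *-monoˡ-≤ {c} {x} {y} 0≤c x≤y = certify
    (solve 3 (λ c x y → c :* y :- c :* x := c :* (y :- x)) refl c x y) (0≤c ⟨*⟩ gap x≤y)

  *-mono-≤ : ∀ {x x′ y y′} → 0# ≤ x′ → 0# ≤ y → x ≤ x′ → y ≤ y′ → x * y ≤ x′ * y′
  *-mono-≤ {x} {x′} {y} {y′} 0≤x′ 0≤y x≤x′ y≤y′ = certify
    (solve 4 (λ x x′ y y′ → x′ :* y′ :- x :* y := x′ :* (y′ :- y) :+ (x′ :- x) :* y) refl x x′ y y′)
    (0≤x′ ⟨*⟩ gap y≤y′ ⟨+⟩ gap x≤x′ ⟨*⟩ 0≤y)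

  +-mono-≤ : ∀ {x x′ y y′} → x ≤ x′ → y ≤ y′ → x + y ≤ x′ + y′
  +-mono-≤ {x} {x′} {y} {y′} x≤x′ y≤y′ = certify
    (solve 4 (λ x x′ y y′ → (x′ :+ y′) :- (x :+ y) := (x′ :- x) :+ (y′ :- y)) refl x x′ y y′)
    (gap x≤x′ ⟨+⟩ gap y≤y′)

  -- Powers, ceilings and logarithms

  0≤1-2s² : ∀ {s} → 0# ≤ s → fromℕ 2 * s ≤ 1# → 0# ≤ 1# - fromℕ 2 * (s * s)
  0≤1-2s² {s} 0≤s 2s≤1 = certify
    (solve 1 (λ s → (con (+ 1) :- con (+ 2) :* (s :* s)) :- con (+ 0) :=
       (con (+ 1) :- con (+ 2) :* s) :+ s :* (con (+ 1) :- con (+ 2) :* s) :+ s) refl s)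
    (gap 2s≤1 ⟨+⟩ 0≤s ⟨*⟩ gap 2s≤1 ⟨+⟩ 0≤s)

  0≤^ : ∀ {x} k → 0# ≤ x → 0# ≤ x ^ k
  0≤^ zero    0≤x = 0≤1
  0≤^ (suc k) 0≤x = 0≤x ⟨*⟩ 0≤^ k 0≤x

  ^-monoˡ-≤ : ∀ {x y} k → 0# ≤ x → x ≤ y → x ^ k ≤ y ^ k
  ^-monoˡ-≤ zero    0≤x x≤y = ≤-refl
  ^-monoˡ-≤ (suc k) 0≤x x≤y =
    *-mono-≤ (≤-trans 0≤x x≤y) (0≤^ k 0≤x) x≤y (^-monoˡ-≤ k 0≤x x≤y)

  ^-distrib-* : ∀ x y k → (x * y) ^ k ≈ x ^ k * y ^ k
  ^-distrib-* x y zero    = sym (*-identityˡ 1#)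
  ^-distrib-* x y (suc k) = trans (*-congˡ (^-distrib-* x y k))
    (solve 4 (λ x y u v → (x :* y) :* (u :* v) := (x :* u) :* (y :* v)) refl x y (x ^ k) (y ^ k))

  1^k≈1 : ∀ k → 1# ^ k ≈ 1#
  1^k≈1 zero    = refl
  1^k≈1 (suc k) = trans (*-identityˡ _) (1^k≈1 k)

  bernoulli : ∀ {x} k → 0# ≤ x → 1# + fromℕ k * x ≤ (1# + x) ^ k
  bernoulli {x} zero 0≤x = ≤-reflexive (solve 1 (λ x → con (+ 1) :+ con (+ 0) :* x := con (+ 1)) refl x)
  bernoulli {x} (suc k) 0≤x = certify
    (solve 3 (λ x n p → (con (+ 1) :+ x) :* p :- (con (+ 1) :+ (con (+ 1) :+ n) :* x) :=
       (con (+ 1) :+ x) :* (p :- (con (+ 1) :+ n :* x)) :+ x :* x :* n) refl x (fromℕ k) ((1# + x) ^ k))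
    ((0≤1 ⟨+⟩ 0≤x) ⟨*⟩ gap (bernoulli k 0≤x) ⟨+⟩ square x ⟨*⟩ 0≤fromℕ k)

  -- The reciprocal form of Bernoulli's inequality: (1 - x)(1 + x) ≤ 1 and
  -- (1 + x) ^ k ≥ 2.
  2*[1-x]^k≤1 : ∀ {x} k → 0# ≤ x → x ≤ 1# → 1# ≤ fromℕ k * x → fromℕ 2 * (1# - x) ^ k ≤ 1#
  2*[1-x]^k≤1 {x} k 0≤x x≤1 1≤kx = begin
    fromℕ 2 * (1# - x) ^ k         ≤⟨ certify (solve 3 (λ p q n →
        q :* p :- con (+ 2) :* p := p :* (q :- (con (+ 1) :+ n)) :+ p :* (n :- con (+ 1))) refl
        ((1# - x) ^ k) ((1# + x) ^ k) (fromℕ k * x))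
        (0≤p ⟨*⟩ gap (bernoulli k 0≤x) ⟨+⟩ 0≤p ⟨*⟩ gap 1≤kx) ⟩
    (1# + x) ^ k * (1# - x) ^ k    ≈⟨ ^-distrib-* (1# + x) (1# - x) k ⟨
    ((1# + x) * (1# - x)) ^ k      ≤⟨ ^-monoˡ-≤ k ((0≤1 ⟨+⟩ 0≤x) ⟨*⟩ gap x≤1) (certify
        (solve 1 (λ x → con (+ 1) :- (con (+ 1) :+ x) :* (con (+ 1) :- x) := x :* x) refl x) (square x)) ⟩
    1# ^ k                         ≈⟨ 1^k≈1 k ⟩
    1#                             ∎
    where
    0≤p : 0# ≤ (1# - x) ^ k
    0≤p = 0≤^ k (gap x≤1)

  -- The order is decidable, so one can descend from the number that the
  -- Archimedean property provides until the next smaller one is below x.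
  ceiling : ∀ {x} → 0# ≤ x → ∃[ k ] x ≤ fromℕ k × fromℕ k ≤ x + 1#
  ceiling {x} 0≤x = let k , x≤k = archimedean x in search k x≤k
    where
    search : ∀ k → x ≤ fromℕ k → ∃[ k ] x ≤ fromℕ k × fromℕ k ≤ x + 1#
    search zero x≤0 = 0 , x≤0 , 0≤x ⟨+⟩ 0≤1
    search (suc k) x≤1+k with x ≤? fromℕ k
    ... | yes x≤k = search k x≤k
    ... | no  x≰k = suc k , x≤1+k , certify
      (solve 2 (λ x k → (x :+ con (+ 1)) :- (con (+ 1) :+ k) := x :- k) refl x (fromℕ k)) (gap (≰⇒≥ x≰k))

  k≤2^k : ∀ k → k ℕ.≤ 2 ℕ.^ k
  k≤2^k zero    = z≤n
  k≤2^k (suc k) = ℕ.≤-trans (ℕ.+-mono-≤ (ℕ.m^n>0 2 k) (k≤2^k k)) (ℕ.+-monoʳ-≤ (2 ℕ.^ k) (ℕ.m≤m+n _ 0))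

  ≤2^archimedean : ∀ x → x ≤ fromℕ 2 ^ proj₁ (archimedean x)
  ≤2^archimedean x = let k , x≤k = archimedean x in
    ≤-trans x≤k (≤-resp refl (fromℕ-^ 2 k) (fromℕ-mono (k≤2^k k)))

  2^-reflect-≤ : ∀ k l → fromℕ 2 ^ k ≤ fromℕ 2 ^ l → k ℕ.≤ l
  2^-reflect-≤ k l 2^k≤2^l with k ℕ.≤? l
  ... | yes k≤l = k≤l
  ... | no  k≰l = ⊥-elim (0≉1 (≤-antisym 0≤1 (*-cancelˡ-≤ (1≤⇒0< 1≤2^l) (certify
      (solve 1 (λ p → p :* con (+ 0) :- p :* con (+ 1) := p :- con (+ 2) :* p) refl (fromℕ 2 ^ l))
      (gap (≤-trans 2^[1+l]≤2^k 2^k≤2^l))))))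
    where
    1≤2^l : 1# ≤ fromℕ 2 ^ l
    1≤2^l = ≤-resp refl (fromℕ-^ 2 l) (1≤fromℕ (ℕ.m^n>0 2 l))

    2^[1+l]≤2^k : fromℕ 2 ^ suc l ≤ fromℕ 2 ^ k
    2^[1+l]≤2^k = ≤-resp (fromℕ-^ 2 (suc l)) (fromℕ-^ 2 k)
      (fromℕ-mono (ℕ.^-monoʳ-≤ 2 (ℕ.≰⇒> k≰l)))

  -- The exponents a / b admitted in the definition of log₂ x are bounded by any
  -- m with x ≤ 2 ^ m, since 2 ^ a ≤ x ^ b ≤ 2 ^ (m b).
  k≤log₂ : ∀ {x} k → 1# ≤ x → fromℕ 2 ^ k ≤ x → fromℕ k ≤ log₂ x
  k≤log₂ {x} k 1≤x 2^k≤x =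
    proj₁ (sup-isSupremum Exponent (fromℕ k , k-exponent) (fromℕ m , m-bound)) (fromℕ k) k-exponent
    where
    Exponent : ℝ → Set
    Exponent r = ∃[ a ] ∃[ b ] 1 ℕ.≤ b × r ≈ fromℕ a ÷ fromℕ b × fromℕ 2 ^ a ≤ x ^ b

    k-exponent : Exponent (fromℕ k)
    k-exponent = k , 1 , s≤s z≤n
      , trans (sym (*-identityʳ _)) (*-congˡ (trans (sym (inverseʳ (0<fromℕ 0)))
          (trans (*-congʳ (+-identityʳ 1#)) (*-identityˡ _))))
      , ≤-resp refl (sym (*-identityʳ x)) 2^k≤x

    m = proj₁ (archimedean x)

    m-bound : UpperBound Exponent (fromℕ m)
    m-bound r (a , suc b , _ , r≈a/b , 2^a≤x^b) = *-cancelˡ-≤ (0<fromℕ b) (begin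
      fromℕ (suc b) * r                                 ≈⟨ *-congˡ r≈a/b ⟩
      fromℕ (suc b) * (fromℕ a * fromℕ (suc b) ⁻¹)      ≈⟨ solve 3 (λ b a c → b :* (a :* c) := a :* (b :* c)) refl _ _ _ ⟩
      fromℕ a * (fromℕ (suc b) * fromℕ (suc b) ⁻¹)      ≈⟨ trans (*-congˡ (inverseʳ (0<fromℕ b))) (*-identityʳ _) ⟩
      fromℕ a                                           ≤⟨ fromℕ-mono (2^-reflect-≤ a (m ℕ.* suc b) (begin
          fromℕ 2 ^ a               ≤⟨ 2^a≤x^b ⟩
          x ^ suc b                 ≤⟨ ^-monoˡ-≤ (suc b) (≤-trans 0≤1 1≤x) (≤2^archimedean x) ⟩
          (fromℕ 2 ^ m) ^ suc b     ≈⟨ ^-assocʳ (fromℕ 2) m (suc b) ⟩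
          fromℕ 2 ^ (m ℕ.* suc b)   ∎)) ⟩
      fromℕ (m ℕ.* suc b)                               ≈⟨ fromℕ-* m (suc b) ⟩
      fromℕ m * fromℕ (suc b)                           ≈⟨ *-comm _ _ ⟩
      fromℕ (suc b) * fromℕ m                           ∎)

  0≤log₂ : ∀ {x} → 1# ≤ x → 0# ≤ log₂ x
  0≤log₂ 1≤x = k≤log₂ 0 1≤x 1≤x

  -- If x ≰ 2 ^ k then k ≤ log₂ x, so the exponent at which the descent stops
  -- exceeds the logarithm by at most 1.
  log₂-ceiling : ∀ {x} → 1# ≤ x → ∃[ k ] x ≤ fromℕ 2 ^ k × fromℕ k ≤ log₂ x + 1#
  log₂-ceiling {x} 1≤x = search (proj₁ (archimedean x)) (≤2^archimedean x)
    where
    search : ∀ k → x ≤ fromℕ 2 ^ k → ∃[ k ] x ≤ fromℕ 2 ^ k × fromℕ k ≤ log₂ x + 1#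
    search zero x≤1 = 0 , x≤1 , 0≤log₂ 1≤x ⟨+⟩ 0≤1
    search (suc k) x≤2^[1+k] with x ≤? fromℕ 2 ^ k
    ... | yes x≤2^k = search k x≤2^k
    ... | no  x≰2^k = suc k , x≤2^[1+k] , certify
      (solve 2 (λ l k → (l :+ con (+ 1)) :- (con (+ 1) :+ k) := l :- k) refl (log₂ x) (fromℕ k))
      (gap (k≤log₂ k 1≤x (≰⇒≥ x≰2^k)))

  -- Sums and means

  x≤∣x∣ : ∀ x → x ≤ ∣ x ∣ᵣ
  x≤∣x∣ x = x≤x⊔y x (- x)

  -x≤∣x∣ : ∀ x → - x ≤ ∣ x ∣ᵣ
  -x≤∣x∣ x = x≤y⊔x x (- x)

  ∣f-g∣≤‖f-g‖∞ : ∀ {n} (f g : Vector ℝ n) i → ∣ f i - g i ∣ᵣ ≤ ‖ f - g ‖∞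
  ∣f-g∣≤‖f-g‖∞ f g zero    = x≤x⊔y _ _
  ∣f-g∣≤‖f-g‖∞ f g (suc i) =
    ≤-trans (∣f-g∣≤‖f-g‖∞ (λ j → f (suc j)) (λ j → g (suc j)) i) (x≤y⊔x _ _)

  sum-mono : ∀ {n} {f g : Vector ℝ n} → (∀ i → f i ≤ g i) → sum f ≤ sum g
  sum-mono {zero}  f≤g = ≤-refl
  sum-mono {suc n} f≤g = +-mono-≤ (f≤g zero) (sum-mono (λ i → f≤g (suc i)))

  sum-nonneg : ∀ {n} {f : Vector ℝ n} → (∀ i → 0# ≤ f i) → 0# ≤ sum f
  sum-nonneg {zero}  0≤f = ≤-refl
  sum-nonneg {suc n} 0≤f = 0≤f zero ⟨+⟩ sum-nonneg (λ i → 0≤f (suc i))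

  term≤sum : ∀ {n} {f : Vector ℝ n} → (∀ i → 0# ≤ f i) → ∀ i → f i ≤ sum f
  term≤sum 0≤f zero = certify (solve 2 (λ x s → (x :+ s) :- x := s) refl _ _)
    (sum-nonneg (λ i → 0≤f (suc i)))
  term≤sum 0≤f (suc i) = ≤-trans (term≤sum (λ j → 0≤f (suc j)) i)
    (certify (solve 2 (λ x s → (x :+ s) :- s := x) refl _ _) (0≤f zero))

  sum-*ˡ : ∀ {n} c (f : Vector ℝ n) → sum (λ i → c * f i) ≈ c * sum f
  sum-*ˡ c f = sym (*-distribˡ-sum c f)

  sum-linear : ∀ {n} a b (f g : Vector ℝ n) → sum (λ i → a * f i + b * g i) ≈ a * sum f + b * sum g
  sum-linear a b f g = trans (sum-+ (λ i → a * f i) (λ i → b * g i)) (+-cong (sum-*ˡ a f) (sum-*ˡ b g))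

  sum-const : ∀ n c → sum {n} (λ _ → c) ≈ fromℕ n * c
  sum-const zero    c = sym (zeroˡ c)
  sum-const (suc n) c = trans (+-congˡ (sum-const n c))
    (solve 2 (λ c n → c :+ n :* c := (con (+ 1) :+ n) :* c) refl c (fromℕ n))

  sum-split : ∀ m {n} (f : Vector ℝ (m ℕ.+ n)) →
              sum f ≈ sum (λ i → f (i ↑ˡ n)) + sum (λ i → f (m ↑ʳ i))
  sum-split zero    f = sym (+-identityˡ _)
  sum-split (suc m) f = trans (+-congˡ (sum-split m (λ i → f (suc i))))
    (solve 3 (λ x y z → x :+ (y :+ z) := x :+ y :+ z) refl _ _ _)

  infix 4 _==_
  _==_ : ∀ {n} → Fin n → Fin n → Bool
  i == j = does (i ≟ j)

  sum-single : ∀ {n} (f : Vector ℝ n) i → sum (λ k → if k == i then f k else 0#) ≈ f i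
  sum-single {suc n} f zero    = trans (+-congˡ (trans (sum-const n 0#) (zeroʳ _))) (+-identityʳ _)
  sum-single {suc n} f (suc i) = trans (+-identityˡ _) (sum-single (λ k → f (suc k)) i)

  sum-indicator : ∀ {n} (A : Subset n) c →
                  sum (λ j → if does (j ∈? A) then c else 0#) ≈ fromℕ ∣ A ∣ * c
  sum-indicator []            c = sym (zeroˡ c)
  sum-indicator (inside ∷ A)  c = trans (+-congˡ (sum-indicator A c))
    (solve 2 (λ c n → c :+ n :* c := (con (+ 1) :+ n) :* c) refl c (fromℕ ∣ A ∣))
  sum-indicator (outside ∷ A) c = trans (+-identityˡ _) (sum-indicator A c)

  nonempty⇒1≤∣_∣ : ∀ {n} (A : Subset n) → Nonempty A → 1 ℕ.≤ ∣ A ∣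
  nonempty⇒1≤∣ inside  ∷ A ∣ _ = s≤s z≤n
  nonempty⇒1≤∣ outside ∷ A ∣ (suc i , there i∈A) = nonempty⇒1≤∣ A ∣ (i , i∈A)

  mean : ∀ {n} → Vector ℝ n → Vector ℝ n → ℝ
  mean p f = sum (λ i → p i * f i)

  mean-affine : ∀ {n} (p : Vector ℝ n) → sum p ≈ 1# → ∀ c d g →
                mean p (λ i → c + d * g i) ≈ c + d * mean p g
  mean-affine p Σp≈1 c d g = begin-equality
    sum (λ i → p i * (c + d * g i))        ≈⟨ sum-cong (λ i → solve 4 (λ p c d g →
                                                 p :* (c :+ d :* g) := c :* p :+ d :* (p :* g)) refl (p i) c d (g i)) ⟩
    sum (λ i → c * p i + d * (p i * g i))  ≈⟨ sum-linear c d p (λ i → p i * g i) ⟩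
    c * sum p + d * mean p g               ≈⟨ +-congʳ (trans (*-congˡ Σp≈1) (*-identityʳ c)) ⟩
    c + d * mean p g                       ∎

  mean-mono : ∀ {n} (p : Vector ℝ n) → (∀ i → 0# ≤ p i) → ∀ {f g} →
              (∀ i → f i ≤ g i) → mean p f ≤ mean p g
  mean-mono p 0≤p f≤g = sum-mono (λ i → *-monoˡ-≤ (0≤p i) (f≤g i))

  -- Conditional samples

  if-member : ∀ {n} {A : Subset n} {k} x → k ∈ A → (if does (k ∈? A) then x else 0#) ≈ x
  if-member {A = A} {k} x k∈A =
    reflexive (≡.cong (λ b → if b then x else 0#) (dec-true (k ∈? A) k∈A))

  if-nonmember : ∀ {n} {A : Subset n} {k} x → ¬ k ∈ A → (if does (k ∈? A) then x else 0#) ≈ 0#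
  if-nonmember {A = A} {k} x k∉A =
    reflexive (≡.cong (λ b → if b then x else 0#) (dec-false (k ∈? A) k∉A))

  module _ {n} (ν : Distribution n) where

    mass-term-nonneg : ∀ A j → 0# ≤ (if does (j ∈? A) then prob ν j else 0#)
    mass-term-nonneg A j with does (j ∈? A)
    ... | true  = nonneg ν j
    ... | false = ≤-refl

    mass-nonneg : ∀ A → 0# ≤ mass ν A
    mass-nonneg A = sum-nonneg (mass-term-nonneg A)

    ∈⇒prob≤mass : ∀ {A j} → j ∈ A → prob ν j ≤ mass ν A
    ∈⇒prob≤mass {A} {j} j∈A = ≤-resp (if-member _ j∈A) refl (term≤sum (mass-term-nonneg A) j)

    sampleProb-nonneg : ∀ A → Nonempty A → ∀ j → 0# ≤ sampleProb ν A j
    sampleProb-nonneg A A≠∅ j with does (j ∈? A) | 0# <? mass ν A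
    ... | true  | yes 0<m = nonneg ν j ⟨*⟩ 0≤⁻¹ 0<m
    ... | true  | no  _   = 0≤⁻¹ (1≤⇒0< (1≤fromℕ (nonempty⇒1≤∣ A ∣ A≠∅)))
    ... | false | _       = ≤-refl

    sampleProb-total : ∀ A → Nonempty A → sum (sampleProb ν A) ≈ 1#
    sampleProb-total A A≠∅ with 0# <? mass ν A
    ... | yes 0<m = begin-equality
      sum (λ j → if does (j ∈? A) then prob ν j ÷ mass ν A else 0#)
        ≈⟨ sum-cong (λ j → scale (does (j ∈? A)) (prob ν j)) ⟩
      sum (λ j → mass ν A ⁻¹ * (if does (j ∈? A) then prob ν j else 0#))
        ≈⟨ sum-*ˡ (mass ν A ⁻¹) (λ j → if does (j ∈? A) then prob ν j else 0#) ⟩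
      mass ν A ⁻¹ * mass ν A
        ≈⟨ trans (*-comm _ _) (inverseʳ 0<m) ⟩
      1# ∎
      where
      scale : ∀ b x → (if b then x ÷ mass ν A else 0#) ≈ mass ν A ⁻¹ * (if b then x else 0#)
      scale true  x = *-comm _ _
      scale false x = sym (zeroʳ _)
    ... | no _ = trans (sum-indicator A (fromℕ ∣ A ∣ ⁻¹))
                       (inverseʳ (1≤⇒0< (1≤fromℕ (nonempty⇒1≤∣ A ∣ A≠∅))))

    sampleProb≤1 : ∀ A → Nonempty A → ∀ j → sampleProb ν A j ≤ 1#
    sampleProb≤1 A A≠∅ j =
      ≤-resp refl (sampleProb-total A A≠∅) (term≤sum (sampleProb-nonneg A A≠∅) j)

    -- This also holds when A has mass zero, for then prob ν j is zero too; it
    -- spares a separate treatment of such sets.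
    sampleProb*mass : ∀ {A j} → j ∈ A → sampleProb ν A j * mass ν A ≈ prob ν j
    sampleProb*mass {A} {j} j∈A with j ∈? A | 0# <? mass ν A
    ... | no  j∉A | _       = ⊥-elim (j∉A j∈A)
    ... | yes _   | yes 0<m = trans (*-assoc _ _ _)
      (trans (*-congˡ (trans (*-comm _ _) (inverseʳ 0<m))) (*-identityʳ _))
    ... | yes _   | no  0≮m = begin-equality
      fromℕ ∣ A ∣ ⁻¹ * mass ν A  ≈⟨ trans (*-congˡ m≈0) (zeroʳ _) ⟩
      0#                         ≈⟨ ≤-antisym (nonneg ν j) (≤-resp refl m≈0 (∈⇒prob≤mass j∈A)) ⟩
      prob ν j                   ∎
      where
      m≈0 : mass ν A ≈ 0#
      m≈0 = ≤-antisym (≮⇒≥ 0≮m) (mass-nonneg A)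

    mass-⊤ : mass ν ⊤ ≈ 1#
    mass-⊤ = trans (sum-cong (λ j → if-member {A = ⊤} {k = j} (prob ν j) ∈⊤)) (total ν)

    sampleProb-⊤ : ∀ j → sampleProb ν ⊤ j ≈ prob ν j
    sampleProb-⊤ j = trans (sym (trans (*-congˡ mass-⊤) (*-identityʳ _))) (sampleProb*mass ∈⊤)

  pair : ∀ {n} → Fin n → Fin n → Subset n
  pair i j = ⁅ i ⁆ ∪ ⁅ j ⁆

  ∈-pairʳ : ∀ {n} (i j : Fin n) → j ∈ pair i j
  ∈-pairʳ i j = x∈p∪q⁺ {p = ⁅ i ⁆} (inj₂ (x∈⁅x⁆ j))

  pair-nonempty : ∀ {n} (i j : Fin n) → Nonempty (pair i j)
  pair-nonempty i j = j , ∈-pairʳ i j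

  module _ {n} (ν : Distribution n) where

    private
      ∉-pair : ∀ {i j k : Fin n} → k ≢ i → k ≢ j → ¬ k ∈ pair i j
      ∉-pair {i} {j} k≢i k≢j k∈A with x∈p∪q⁻ ⁅ i ⁆ ⁅ j ⁆ k∈A
      ... | inj₁ k∈i = k≢i (x∈⁅y⁆⇒x≡y i k∈i)
      ... | inj₂ k∈j = k≢j (x∈⁅y⁆⇒x≡y j k∈j)

    mass-pair : ∀ {i j} → i ≢ j → mass ν (pair i j) ≈ prob ν i + prob ν j
    mass-pair {i} {j} i≢j = begin-equality
      mass ν (pair i j)
        ≈⟨ sum-cong split ⟩
      sum (λ k → (if k == i then prob ν k else 0#) + (if k == j then prob ν k else 0#))
        ≈⟨ sum-+ (λ k → if k == i then prob ν k else 0#) _ ⟩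
      sum (λ k → if k == i then prob ν k else 0#) + sum (λ k → if k == j then prob ν k else 0#)
        ≈⟨ +-cong (sum-single (prob ν) i) (sum-single (prob ν) j) ⟩
      prob ν i + prob ν j ∎
      where
      split : ∀ k → (if does (k ∈? pair i j) then prob ν k else 0#) ≈
                    (if k == i then prob ν k else 0#) + (if k == j then prob ν k else 0#)
      split k with k ≟ i | k ≟ j
      ... | yes ≡.refl | yes ≡.refl = ⊥-elim (i≢j ≡.refl)
      ... | yes ≡.refl | no  _      = trans (if-member _ (x∈p∪q⁺ (inj₁ (x∈⁅x⁆ i)))) (sym (+-identityʳ _))
      ... | no  _      | yes ≡.refl = trans (if-member _ (∈-pairʳ i j)) (sym (+-identityˡ _))
      ... | no  k≢i    | no  k≢j    = trans (if-nonmember _ (∉-pair k≢i k≢j)) (sym (+-identityˡ 0#))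

    mass-pair-diagonal : ∀ j → mass ν (pair j j) ≈ prob ν j
    mass-pair-diagonal j = trans (sum-cong single) (sum-single (prob ν) j)
      where
      single : ∀ k → (if does (k ∈? pair j j) then prob ν k else 0#) ≈ (if k == j then prob ν k else 0#)
      single k with k ≟ j
      ... | yes ≡.refl = if-member _ (∈-pairʳ j j)
      ... | no  k≢j    = if-nonmember _ (∉-pair k≢j k≢j)

  module _ {n} {μ ν : Distribution n} (μ≋ν : μ ≋ ν) where

    mass-cong : ∀ A → mass μ A ≈ mass ν A
    mass-cong A = sum-cong (λ j → term j (does (j ∈? A)))
      where
      term : ∀ j b → (if b then prob μ j else 0#) ≈ (if b then prob ν j else 0#)
      term j true  = μ≋ν j
      term j false = refl

    sampleProb-cong : ∀ A j → sampleProb μ A j ≈ sampleProb ν A j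
    sampleProb-cong A j with j ∈? A
    ... | no  _   = refl
    ... | yes j∈A with 0# <? mass μ A | 0# <? mass ν A
    ...   | no  _    | no  _   = refl
    ...   | yes 0<m  | no  0≮m = ⊥-elim (0<⇒≉0 0<m (trans (mass-cong A)
                                   (≤-antisym (≮⇒≥ 0≮m) (mass-nonneg ν A))))
    ...   | no  0≮m  | yes 0<m = ⊥-elim (0<⇒≉0 0<m (trans (sym (mass-cong A))
                                   (≤-antisym (≮⇒≥ 0≮m) (mass-nonneg μ A))))
    ...   | yes 0<m  | yes 0<m′ = *-cancelˡ-≈ 0<m (begin-equality
      mass μ A * (prob μ j ÷ mass μ A)  ≈⟨ undo 0<m ⟩
      prob μ j                          ≈⟨ μ≋ν j ⟩
      prob ν j                          ≈⟨ undo 0<m′ ⟨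
      mass ν A * (prob ν j ÷ mass ν A)  ≈⟨ *-congʳ (mass-cong A) ⟨
      mass μ A * (prob ν j ÷ mass ν A)  ∎)
      where
      undo : ∀ {m p} → 0# < m → m * (p ÷ m) ≈ p
      undo {m} {p} 0<m = trans (solve 3 (λ m p i → m :* (p :* i) := p :* (m :* i)) refl m p (m ⁻¹))
                               (trans (*-congˡ (inverseʳ 0<m)) (*-identityʳ p))

  -- Algorithms and fair coins

  half : ℝ
  half = fromℕ 2 ⁻¹

  2*half≈1 : fromℕ 2 * half ≈ 1#
  2*half≈1 = inverseʳ (0<fromℕ 1)

  0≤half : 0# ≤ half
  0≤half = 0≤⁻¹ (0<fromℕ 1)

  Pr-total : ∀ {n q} (T : Algorithm n q) ν → Pr accept T ν + Pr reject T ν ≈ 1#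
  Pr-total (halt accept) ν = +-identityʳ 1#
  Pr-total (halt reject) ν = +-identityˡ 1#
  Pr-total (toss T) ν = begin-equality
    half * (a + b) + half * (c + d)    ≈⟨ solve 5 (λ h a b c d →
        h :* (a :+ b) :+ h :* (c :+ d) := h :* ((a :+ c) :+ (b :+ d))) refl half a b c d ⟩
    half * ((a + c) + (b + d))         ≈⟨ *-congˡ (+-cong (Pr-total (T true) ν) (Pr-total (T false) ν)) ⟩
    half * (1# + 1#)                   ≈⟨ solve 1 (λ h → h :* (con (+ 1) :+ con (+ 1)) := con (+ 2) :* h) refl half ⟩
    fromℕ 2 * half                     ≈⟨ 2*half≈1 ⟩
    1#                                 ∎
    where
    a = Pr accept (T true) ν
    b = Pr accept (T false) ν
    c = Pr reject (T true) ν
    d = Pr reject (T false) ν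
  Pr-total (sample A A≠∅ T) ν = begin-equality
    mean p (λ j → Pr accept (T j) ν) + mean p (λ j → Pr reject (T j) ν)
      ≈⟨ sum-+ (λ j → p j * Pr accept (T j) ν) (λ j → p j * Pr reject (T j) ν) ⟨
    sum (λ j → p j * Pr accept (T j) ν + p j * Pr reject (T j) ν)
      ≈⟨ sum-cong (λ j → trans (sym (distribˡ (p j) _ _))
           (trans (*-congˡ (Pr-total (T j) ν)) (*-identityʳ (p j)))) ⟩
    sum p
      ≈⟨ sampleProb-total ν A A≠∅ ⟩
    1# ∎
    where
    p = sampleProb ν A

  1-≤Pr-accept : ∀ {n q} (T : Algorithm n q) ν {δ} → Pr reject T ν ≤ δ → 1# - δ ≤ Pr accept T ν
  1-≤Pr-accept T ν {δ} r≤δ = certify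
    (solve 3 (λ a r d → a :- (con (+ 1) :- d) :=
       (d :- r) :+ con (+ 1) :* ((a :+ r) :- con (+ 1))) refl (Pr accept T ν) (Pr reject T ν) δ)
    (gap r≤δ ⟨+⟩ vanish 1# (Pr-total T ν))

  1-≤Pr-reject : ∀ {n q} (T : Algorithm n q) ν {δ} → Pr accept T ν ≤ δ → 1# - δ ≤ Pr reject T ν
  1-≤Pr-reject T ν {δ} a≤δ = certify
    (solve 3 (λ a r d → r :- (con (+ 1) :- d) :=
       (d :- a) :+ con (+ 1) :* ((a :+ r) :- con (+ 1))) refl (Pr accept T ν) (Pr reject T ν) δ)
    (gap a≤δ ⟨+⟩ vanish 1# (Pr-total T ν))

  data Coins (A : Set) : Set where
    return : A → Coins A
    flip   : (Bool → Coins A) → Coins A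

  withCoins : ∀ {A : Set} {n q} → Coins A → (A → Algorithm n q) → Algorithm n q
  withCoins (return a) T = T a
  withCoins (flip c)   T = toss (λ b → withCoins (c b) T)

  coinMean : ∀ {A : Set} → Coins A → (A → ℝ) → ℝ
  coinMean (return a) f = f a
  coinMean (flip c)   f = half * (coinMean (c true) f + coinMean (c false) f)

  Pr-withCoins : ∀ {A : Set} {n q} v (c : Coins A) (T : A → Algorithm n q) ν →
                 Pr v (withCoins c T) ν ≈ coinMean c (λ a → Pr v (T a) ν)
  Pr-withCoins v (return a) T ν = refl
  Pr-withCoins v (flip c)   T ν =
    *-congˡ (+-cong (Pr-withCoins v (c true) T ν) (Pr-withCoins v (c false) T ν))

  coinMean-affine : ∀ {A : Set} (c : Coins A) x y g →
                    coinMean c (λ a → x + y * g a) ≈ x + y * coinMean c g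
  coinMean-affine (return a) x y g = refl
  coinMean-affine (flip c)   x y g = begin-equality
    half * (coinMean (c true) (λ a → x + y * g a) + coinMean (c false) (λ a → x + y * g a))
      ≈⟨ *-congˡ (+-cong (coinMean-affine (c true) x y g) (coinMean-affine (c false) x y g)) ⟩
    half * ((x + y * u) + (x + y * v))
      ≈⟨ solve 5 (λ h x y u v → h :* ((x :+ y :* u) :+ (x :+ y :* v)) :=
           (con (+ 2) :* h) :* x :+ y :* (h :* (u :+ v))) refl half x y u v ⟩
    (fromℕ 2 * half) * x + y * (half * (u + v))
      ≈⟨ +-congʳ (trans (*-congʳ 2*half≈1) (*-identityˡ x)) ⟩
    x + y * (half * (u + v)) ∎
    where
    u = coinMean (c true) g
    v = coinMean (c false) g

  coinMean-mono : ∀ {A : Set} (c : Coins A) {f g : A → ℝ} →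
                  (∀ a → f a ≤ g a) → coinMean c f ≤ coinMean c g
  coinMean-mono (return a) f≤g = f≤g a
  coinMean-mono (flip c)   f≤g =
    *-monoˡ-≤ 0≤half (+-mono-≤ (coinMean-mono (c true) f≤g) (coinMean-mono (c false) f≤g))

  coinMean-const : ∀ {A : Set} (c : Coins A) {f : A → ℝ} {x} → (∀ a → f a ≈ x) → coinMean c f ≈ x
  coinMean-const c {f} {x} f≈x = ≤-antisym
    (≤-resp refl const (coinMean-mono c (λ a → ≤-reflexive (trans (f≈x a) (sym (pad a))))))
    (≤-resp const refl (coinMean-mono c (λ a → ≤-reflexive (trans (pad a) (sym (f≈x a))))))
    where
    pad : ∀ a → x + 0# * f a ≈ x
    pad a = trans (+-congˡ (zeroˡ _)) (+-identityʳ x)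

    const : coinMean c (λ a → x + 0# * f a) ≈ x
    const = trans (coinMean-affine c x 0# f) (trans (+-congˡ (zeroˡ _)) (+-identityʳ x))

  coinMean-nonneg : ∀ {A : Set} (c : Coins A) {g : A → ℝ} → (∀ a → 0# ≤ g a) → 0# ≤ coinMean c g
  coinMean-nonneg c 0≤g = ≤-resp (coinMean-const c (λ _ → refl)) refl (coinMean-mono c 0≤g)

  -- Every index is given weight at least 2 ^ - k.  When n exceeds half of the
  -- available 2 ^ k, the first toss separates the first 2 ^ (k - 1) indices from
  -- the others.  The family h makes the induction apply to both parts.
  leaves : ∀ {A : Set} k {n} → 1 ℕ.≤ n → n ℕ.≤ 2 ℕ.^ k → (h : Fin n → A) →
    Σ[ c ∈ Coins A ] (∀ g → (∀ a → 0# ≤ g a) → sum (λ i → g (h i)) ≤ fromℕ (2 ℕ.^ k) * coinMean c g)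
  leaves zero {suc zero} _ _ h = return (h zero) , λ g 0≤g →
    ≤-reflexive (solve 1 (λ x → x :+ con (+ 0) := (con (+ 1) :+ con (+ 0)) :* x) refl (g (h zero)))
  leaves zero {suc (suc n)} _ (s≤s ()) h
  leaves {A} (suc k) {n} 1≤n n≤2^[1+k] h with n ℕ.≤? 2 ℕ.^ k
  ... | yes n≤2^k = let c , bound = leaves k 1≤n n≤2^k h in c , λ g 0≤g →
    ≤-trans (bound g 0≤g) (certify
      (solve 3 (λ t s m → s :* m :- t :* m := (s :- t) :* m) refl _ _ _)
      (gap (fromℕ-mono (ℕ.m≤m+n (2 ℕ.^ k) _)) ⟨*⟩ coinMean-nonneg c 0≤g))
  ... | no n≰2^k with ℕ.m≤n⇒∃[o]m+o≡n (ℕ.≰⇒> n≰2^k)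
  ...   | r , ≡.refl = flip branches , bound
    where
    N = 2 ℕ.^ k

    -- The index type is Fin (1 + N + r); splitting off the first N indices
    -- needs it in the form Fin (N + (1 + r)).
    h′ : Fin (N ℕ.+ suc r) → A
    h′ i = h (≡.subst Fin (ℕ.+-suc N r) i)

    left = leaves k {N} (ℕ.m^n>0 2 k) ℕ.≤-refl (λ i → h′ (i ↑ˡ suc r))

    right = leaves k {suc r} (s≤s z≤n)
      (ℕ.+-cancelˡ-≤ N (suc r) N (ℕ.≤-trans (ℕ.≤-reflexive (ℕ.+-suc N r))
        (ℕ.≤-trans n≤2^[1+k] (ℕ.≤-reflexive (≡.cong (N ℕ.+_) (ℕ.+-identityʳ N))))))
      (λ i → h′ (N ↑ʳ i))

    branches : Bool → Coins A
    branches b = if b then proj₁ left else proj₁ right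

    sum-h′ : ∀ {m} (e : N ℕ.+ suc r ≡ m) (f : Fin m → ℝ) → sum f ≈ sum (λ i → f (≡.subst Fin e i))
    sum-h′ ≡.refl f = refl

    bound : ∀ g → (∀ a → 0# ≤ g a) →
            sum (λ i → g (h i)) ≤ fromℕ (2 ℕ.^ suc k) * coinMean (flip branches) g
    bound g 0≤g = begin
      sum (λ i → g (h i))                                                 ≈⟨ sum-h′ (ℕ.+-suc N r) (λ i → g (h i)) ⟩
      sum (λ i → g (h′ i))                                                ≈⟨ sum-split N (λ i → g (h′ i)) ⟩
      sum (λ i → g (h′ (i ↑ˡ suc r))) + sum (λ i → g (h′ (N ↑ʳ i)))       ≤⟨ +-mono-≤ (proj₂ left g 0≤g) (proj₂ right g 0≤g) ⟩
      fromℕ N * u + fromℕ N * v                                           ≈⟨ *-identityˡ _ ⟨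
      1# * (fromℕ N * u + fromℕ N * v)                                    ≈⟨ *-congʳ 2*half≈1 ⟨
      (fromℕ 2 * half) * (fromℕ N * u + fromℕ N * v)                      ≈⟨ solve 4 (λ h N u v →
          (con (+ 2) :* h) :* (N :* u :+ N :* v) := (con (+ 2) :* N) :* (h :* (u :+ v))) refl half (fromℕ N) u v ⟩
      (fromℕ 2 * fromℕ N) * (half * (u + v))                              ≈⟨ *-congʳ (fromℕ-* 2 N) ⟨
      fromℕ (2 ℕ.* N) * (half * (u + v))                                  ∎
      where
      u = coinMean (proj₁ left) g
      v = coinMean (proj₁ right) g

  n≤2^k≤2n : ∀ n → ∃[ k ] suc n ℕ.≤ 2 ℕ.^ k × 2 ℕ.^ k ℕ.≤ 2 ℕ.* suc n
  n≤2^k≤2n zero = 0 , s≤s z≤n , s≤s z≤n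
  n≤2^k≤2n (suc n) with n≤2^k≤2n n
  ... | k , n≤2^k , 2^k≤2n with suc (suc n) ℕ.≤? 2 ℕ.^ k
  ...   | yes 1+n≤2^k = k , 1+n≤2^k , ℕ.≤-trans 2^k≤2n (ℕ.*-monoʳ-≤ 2 (ℕ.n≤1+n (suc n)))
  ...   | no  1+n≰2^k = suc k
    , ℕ.≤-trans (ℕ.+-mono-≤ (s≤s z≤n) (ℕ.m≤m+n (suc n) 0)) (ℕ.*-monoʳ-≤ 2 n≤2^k)
    , ℕ.*-monoʳ-≤ 2 (ℕ.≤-trans (ℕ.≤-pred (ℕ.≰⇒> 1+n≰2^k)) (ℕ.n≤1+n (suc n)))

  -- Fair coins cannot produce the uniform distribution on [n] unless n is a
  -- power of two, but every element can be given at least half of its weight.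
  coins-covering : ∀ n → Σ[ c ∈ Coins (Fin (suc n)) ] (∀ g → (∀ i → 0# ≤ g i) →
                   sum g ≤ fromℕ 2 * fromℕ (suc n) * coinMean c g)
  coins-covering n =
    let k , n≤2^k , 2^k≤2n = n≤2^k≤2n n
        c , bound = leaves k (s≤s z≤n) n≤2^k (λ i → i)
    in c , λ g 0≤g → ≤-trans (bound g 0≤g) (certify
      (solve 3 (λ t s m → s :* m :- t :* m := (s :- t) :* m) refl _ _ _)
      (gap (≤-resp refl (fromℕ-* 2 (suc n)) (fromℕ-mono 2^k≤2n)) ⟨*⟩ coinMean-nonneg c 0≤g))

  -- One trial and its mean

  module Tester {n} (μ : Distribution n) (witness : Fin n) (c : Coins (Fin n)) where

    -- Centring at the exact probability under μ, and not at 1/2, makes the mean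
    -- vanish when the samples come from μ.
    deviation : Fin n → Fin n → Fin n → ℝ
    deviation i j x = (if x == j then 1# else 0#) - sampleProb μ (pair i j) j

    trial : ∀ {q} → (ℝ → Algorithm n q) → Algorithm n (3 ℕ.+ q)
    trial T =
      withCoins c λ i →
      sample ⊤ (witness , ∈⊤) λ j →
      sample (pair i j) (pair-nonempty i j) λ x →
      sample (pair i j) (pair-nonempty i j) λ y →
      T (deviation i j x * deviation i j y)

    bias : Distribution n → Fin n → Fin n → ℝ
    bias ν i j = sampleProb ν (pair i j) j - sampleProb μ (pair i j) j

    -- The conditional mean of the product of deviations given i; the mean over
    -- i is the score.
    pairScore : Distribution n → Fin n → ℝ
    pairScore ν i = mean (sampleProb ν ⊤) (λ j → bias ν i j * bias ν i j)

    score : Distribution n → ℝ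
    score ν = coinMean c (pairScore ν)

    mean-deviation : ∀ ν i j → mean (sampleProb ν (pair i j)) (deviation i j) ≈ bias ν i j
    mean-deviation ν i j = begin-equality
      mean p (deviation i j)
        ≈⟨ sum-cong (λ x → expand (x == j) (p x)) ⟩
      sum (λ x → 1# * (if x == j then p x else 0#) + - m * p x)
        ≈⟨ sum-linear 1# (- m) (λ x → if x == j then p x else 0#) p ⟩
      1# * sum (λ x → if x == j then p x else 0#) + - m * sum p
        ≈⟨ +-cong (*-congˡ (sum-single p j)) (*-congˡ (sampleProb-total ν (pair i j) (pair-nonempty i j))) ⟩
      1# * p j + - m * 1#
        ≈⟨ solve 2 (λ p m → con (+ 1) :* p :+ (:- m) :* con (+ 1) := p :- m) refl (p j) m ⟩
      bias ν i j ∎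
      where
      p = sampleProb ν (pair i j)
      m = sampleProb μ (pair i j) j

      expand : ∀ b x → x * ((if b then 1# else 0#) - m) ≈ 1# * (if b then x else 0#) + - m * x
      expand true  x = solve 2 (λ x m → x :* (con (+ 1) :- m) := con (+ 1) :* x :+ (:- m) :* x) refl x m
      expand false x = solve 2 (λ x m → x :* (con (+ 0) :- m) := con (+ 1) :* con (+ 0) :+ (:- m) :* x) refl x m

    -1≤deviation≤1 : ∀ i j x → - 1# ≤ deviation i j x × deviation i j x ≤ 1#
    -1≤deviation≤1 i j x with x == j
    ... | true  = certify (solve 1 (λ m → (con (+ 1) :- m) :- (:- con (+ 1)) := con (+ 1) :+ (con (+ 1) :- m)) refl m) (0≤1 ⟨+⟩ gap m≤1)
                , certify (solve 1 (λ m → con (+ 1) :- (con (+ 1) :- m) := m) refl m) 0≤m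
      where
      m = sampleProb μ (pair i j) j
      0≤m = sampleProb-nonneg μ (pair i j) (pair-nonempty i j) j
      m≤1 = sampleProb≤1 μ (pair i j) (pair-nonempty i j) j
    ... | false = certify (solve 1 (λ m → (con (+ 0) :- m) :- (:- con (+ 1)) := con (+ 1) :- m) refl m) (gap m≤1)
                , certify (solve 1 (λ m → con (+ 1) :- (con (+ 0) :- m) := con (+ 1) :+ m) refl m) (0≤1 ⟨+⟩ 0≤m)
      where
      m = sampleProb μ (pair i j) j
      0≤m = sampleProb-nonneg μ (pair i j) (pair-nonempty i j) j
      m≤1 = sampleProb≤1 μ (pair i j) (pair-nonempty i j) j

    -1≤product≤1 : ∀ i j x y → - 1# ≤ deviation i j x * deviation i j y × deviation i j x * deviation i j y ≤ 1#
    -1≤product≤1 i j x y =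
      let -1≤a , a≤1 = -1≤deviation≤1 i j x
          -1≤b , b≤1 = -1≤deviation≤1 i j y
          a = deviation i j x
          b = deviation i j y
      -- 2 (1 + a b) = (1 + a)(1 + b) + (1 - a)(1 - b), and likewise with - b for b.
      in *-cancelˡ-≤ (0<fromℕ 1) (certify
           (solve 2 (λ a b → con (+ 2) :* (a :* b) :- con (+ 2) :* (:- con (+ 1)) :=
              (a :- (:- con (+ 1))) :* (b :- (:- con (+ 1))) :+ (con (+ 1) :- a) :* (con (+ 1) :- b)) refl a b)
           (gap -1≤a ⟨*⟩ gap -1≤b ⟨+⟩ gap a≤1 ⟨*⟩ gap b≤1))
       , *-cancelˡ-≤ (0<fromℕ 1) (certify
           (solve 2 (λ a b → con (+ 2) :* con (+ 1) :- con (+ 2) :* (a :* b) :=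
              (a :- (:- con (+ 1))) :* (con (+ 1) :- b) :+ (con (+ 1) :- a) :* (b :- (:- con (+ 1)))) refl a b)
           (gap -1≤a ⟨*⟩ gap b≤1 ⟨+⟩ gap a≤1 ⟨*⟩ gap -1≤b))

    -- Given i and j the two samples are independent, so the product of their
    -- deviations has mean bias².  Because the bound is affine in z, the score is
    -- the only feature of ν that enters the conclusion.
    Pr-trial : ∀ {q} v (T : ℝ → Algorithm n q) ν a b →
               (∀ z → - 1# ≤ z → z ≤ 1# → Pr v (T z) ν ≤ a + b * z) →
               Pr v (trial T) ν ≤ a + b * score ν
    Pr-trial v T ν a b bound = begin
      Pr v (trial T) ν                                  ≈⟨ Pr-withCoins v c _ ν ⟩
      coinMean c (λ i → Pr v (afterCoins i) ν)          ≤⟨ coinMean-mono c bound-i ⟩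
      coinMean c (λ i → a + b * pairScore ν i)          ≈⟨ coinMean-affine c a b (pairScore ν) ⟩
      a + b * score ν                                   ∎
      where
      afterCoins : Fin n → Algorithm n _
      afterCoins i =
        sample ⊤ (witness , ∈⊤) λ j →
        sample (pair i j) (pair-nonempty i j) λ x →
        sample (pair i j) (pair-nonempty i j) λ y →
        T (deviation i j x * deviation i j y)

      affine : ∀ A → Nonempty A → ∀ {f} a b g → (∀ x → f x ≤ a + b * g x) →
               mean (sampleProb ν A) f ≤ a + b * mean (sampleProb ν A) g
      affine A A≠∅ a b g f≤ = ≤-resp refl
        (mean-affine (sampleProb ν A) (sampleProb-total ν A A≠∅) a b g)
        (mean-mono (sampleProb ν A) (sampleProb-nonneg ν A A≠∅) f≤)

      f-y : Fin n → Fin n → Fin n → Fin n → ℝ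
      f-y i j x y = Pr v (T (deviation i j x * deviation i j y)) ν

      f-x : Fin n → Fin n → Fin n → ℝ
      f-x i j x = mean (sampleProb ν (pair i j)) (f-y i j x)

      bound-x : ∀ i j x → f-x i j x ≤ a + b * bias ν i j * deviation i j x
      bound-x i j x = ≤-resp refl
        (+-congˡ (trans (*-congˡ (mean-deviation ν i j))
          (solve 3 (λ b d e → b :* d :* e := b :* e :* d) refl b (deviation i j x) (bias ν i j))))
        (affine (pair i j) (pair-nonempty i j) a (b * deviation i j x) (deviation i j) (λ y →
          let l , u = -1≤product≤1 i j x y in
          ≤-resp refl (+-congˡ (sym (*-assoc b _ _))) (bound _ l u)))

      bound-j : ∀ i j → mean (sampleProb ν (pair i j)) (f-x i j) ≤ a + b * (bias ν i j * bias ν i j)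
      bound-j i j = ≤-resp refl
        (+-congˡ (trans (*-congˡ (mean-deviation ν i j)) (*-assoc b _ _)))
        (affine (pair i j) (pair-nonempty i j) a (b * bias ν i j) (deviation i j) (bound-x i j))

      bound-i : ∀ i → Pr v (afterCoins i) ν ≤ a + b * pairScore ν i
      bound-i i = affine ⊤ (witness , ∈⊤) a b (λ j → bias ν i j * bias ν i j) (bound-j i)

    score-null : ∀ {ν} → ν ≋ μ → score ν ≈ 0#
    score-null {ν} ν≋μ = coinMean-const c λ i → trans
      (sum-cong λ j → trans (*-congˡ (trans (*-congʳ (bias≈0 i j)) (zeroˡ _))) (zeroʳ _))
      (trans (sum-const n 0#) (zeroʳ _))
      where
      bias≈0 : ∀ i j → bias ν i j ≈ 0#
      bias≈0 i j = trans (+-congʳ (sampleProb-cong {μ = ν} {μ} ν≋μ (pair i j) j)) (-‿inverseʳ _)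

    -- Betting on the trials

    -- Here s is the fraction of the wealth w staked on each trial, and D the
    -- wealth at which the algorithm rejects.
    module Betting (s D : ℝ) (0≤s : 0# ≤ s) (2s≤1 : fromℕ 2 * s ≤ 1#) (0≤D : 0# ≤ D) where

      run : ∀ N → ℝ → Algorithm n (N ℕ.* 3)
      run zero    w = halt (if does (w <? D) then accept else reject)
      run (suc N) w = trial (λ z → run N (w * (1# + s * z)))

      -- With score zero each trial multiplies the wealth by a factor of mean 1, so
      -- this is Markov's inequality for a martingale: the induction replaces the
      -- verdict by its linear upper bound δ w and averages one trial at a time.
      Pr-reject-null : ∀ ν δ → 0# ≤ δ → 1# ≤ δ * D → score ν ≈ 0# →
                       ∀ N w → 0# ≤ w → Pr reject (run N w) ν ≤ δ * w
      Pr-reject-null ν δ 0≤δ 1≤δD score≈0 zero w 0≤w with w <? D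
      ... | yes _   = 0≤δ ⟨*⟩ 0≤w
      ... | no  w≮D = ≤-trans 1≤δD (*-monoˡ-≤ 0≤δ (≮⇒≥ w≮D))
      Pr-reject-null ν δ 0≤δ 1≤δD score≈0 (suc N) w 0≤w = ≤-resp refl
        (trans (+-congˡ (trans (*-congˡ score≈0) (zeroʳ _))) (+-identityʳ _))
        (Pr-trial reject (λ z → run N (w * (1# + s * z))) ν (δ * w) (δ * w * s) λ z -1≤z z≤1 → ≤-resp refl
          (solve 4 (λ d w s z → d :* (w :* (con (+ 1) :+ s :* z)) := d :* w :+ d :* w :* s :* z) refl δ w s z)
          (Pr-reject-null ν δ 0≤δ 1≤δD score≈0 N _ (0≤w ⟨*⟩ 0≤1+sz z -1≤z)))
        where
        0≤1+sz : ∀ z → - 1# ≤ z → 0# ≤ 1# + s * z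
        0≤1+sz z -1≤z = certify
          (solve 2 (λ s z → (con (+ 1) :+ s :* z) :- con (+ 0) :=
             s :* (z :- (:- con (+ 1))) :+ (con (+ 1) :- con (+ 2) :* s) :+ s) refl s z)
          (0≤s ⟨*⟩ gap -1≤z ⟨+⟩ gap 2s≤1 ⟨+⟩ 0≤s)

      -- Bounds the mean factor by which one trial changes the reciprocal of the
      -- wealth when the score is at least 4 s.
      ρ : ℝ
      ρ = 1# - fromℕ 2 * (s * s)

      0≤ρ : 0# ≤ ρ
      0≤ρ = 0≤1-2s² 0≤s 2s≤1

      -- Markov's inequality for the reciprocal of the wealth, of which u is an
      -- upper bound.  For x = s z one has 1 / (1 + x) ≤ 1 + 2 s² - x, since
      -- x² ≤ s² and s ≤ 1/2; the mean of the right-hand side is at most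
      -- 1 + 2 s² - 4 s², that is ρ.
      Pr-accept-far : ∀ ν → fromℕ 4 * s ≤ score ν →
                      ∀ N w u → 0# ≤ u → 1# ≤ w * u → Pr accept (run N w) ν ≤ D * ρ ^ N * u
      Pr-accept-far ν 4s≤score zero w u 0≤u 1≤wu with w <? D
      ... | yes w<D = ≤-trans 1≤wu (certify
            (solve 3 (λ w d u → d :* con (+ 1) :* u :- w :* u := (d :- w) :* u) refl w D u)
            (gap (proj₁ w<D) ⟨*⟩ 0≤u))
      ... | no  _   = 0≤D ⟨*⟩ 0≤1 ⟨*⟩ 0≤u
      Pr-accept-far ν 4s≤score (suc N) w u 0≤u 1≤wu = ≤-trans
        (Pr-trial accept (λ z → run N (w * (1# + s * z))) ν (K * (1# + fromℕ 2 * (s * s))) (- (K * s)) step)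
        (certify (solve 5 (λ d p u s m → d :* ((con (+ 1) :- con (+ 2) :* (s :* s)) :* p) :* u
                   :- (d :* p :* u :* (con (+ 1) :+ con (+ 2) :* (s :* s)) :+ (:- (d :* p :* u :* s)) :* m)
                   := d :* p :* u :* s :* (m :- con (+ 4) :* s)) refl D (ρ ^ N) u s (score ν))
          (0≤K ⟨*⟩ 0≤s ⟨*⟩ gap 4s≤score))
        where
        K = D * ρ ^ N * u

        0≤K : 0# ≤ K
        0≤K = 0≤D ⟨*⟩ 0≤^ N 0≤ρ ⟨*⟩ 0≤u

        step : ∀ z → - 1# ≤ z → z ≤ 1# → Pr accept (run N (w * (1# + s * z))) ν ≤
               K * (1# + fromℕ 2 * (s * s)) + - (K * s) * z
        step z -1≤z z≤1 = ≤-resp refl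
          (solve 4 (λ k u s z → k :* (u :* (con (+ 1) :+ con (+ 2) :* (s :* s) :- s :* z)) :=
             k :* u :* (con (+ 1) :+ con (+ 2) :* (s :* s)) :+ (:- (k :* u :* s)) :* z) refl (D * ρ ^ N) u s z)
          (Pr-accept-far ν 4s≤score N (w * (1# + s * z)) (u * (1# + fromℕ 2 * (s * s) - s * z))
            (0≤u ⟨*⟩ certify
              (solve 2 (λ s z → (con (+ 1) :+ con (+ 2) :* (s :* s) :- s :* z) :- con (+ 0) :=
                 (con (+ 1) :- con (+ 2) :* s) :+ s :+ con (+ 2) :* (s :* s) :+ s :* (con (+ 1) :- z)) refl s z)
              (gap 2s≤1 ⟨+⟩ 0≤s ⟨+⟩ 0≤fromℕ 2 ⟨*⟩ (0≤s ⟨*⟩ 0≤s) ⟨+⟩ 0≤s ⟨*⟩ gap z≤1))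
            (certify
              (solve 4 (λ w u s z →
                 (w :* (con (+ 1) :+ s :* z)) :* (u :* (con (+ 1) :+ con (+ 2) :* (s :* s) :- s :* z)) :- con (+ 1) :=
                 (w :* u :- con (+ 1)) :+ w :* u :* (s :* s :*
                   ((con (+ 1) :- z) :* (z :- (:- con (+ 1))) :+ (con (+ 1) :- con (+ 2) :* s)
                     :+ con (+ 2) :* s :* (z :- (:- con (+ 1)))))) refl w u s z)
              (gap 1≤wu ⟨+⟩ ≤-trans 0≤1 1≤wu ⟨*⟩ (0≤s ⟨*⟩ 0≤s ⟨*⟩
                (gap z≤1 ⟨*⟩ gap -1≤z ⟨+⟩ gap 2s≤1 ⟨+⟩ 0≤fromℕ 2 ⟨*⟩ 0≤s ⟨*⟩ gap -1≤z)))))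

  -- The score of a far distribution

  module Separation
    {n} (μ : Distribution (suc n)) (c : Coins (Fin (suc n)))
    (c-covering : ∀ g → (∀ i → 0# ≤ g i) → sum g ≤ fromℕ 2 * fromℕ (suc n) * coinMean c g)
    (ε : ℝ) (0<ε : 0# < ε) (ε<1 : ε < 1#)
    (near : ‖ prob μ - uniform (suc n) ‖∞ < ε ÷ (fromℕ 100 * fromℕ (suc n)))
    where

    open Tester μ zero c

    N : ℝ
    N = fromℕ (suc n)

    0≤N : 0# ≤ N
    0≤N = 0≤fromℕ (suc n)

    0≤ε : 0# ≤ ε
    0≤ε = proj₁ 0<ε

    θ : ℝ
    θ = ε ÷ (fromℕ 100 * N)

    0<fromℕ*N : ∀ k → 0# < fromℕ (suc k) * N
    0<fromℕ*N k = ≉0⇒0< (0≤fromℕ (suc k) ⟨*⟩ 0≤N)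
      (λ kN≈0 → fromℕ≉0 (n ℕ.+ k ℕ.* suc n) (trans (fromℕ-* (suc k) (suc n)) kN≈0))

    ε≈100Nθ : ε ≈ fromℕ 100 * N * θ
    ε≈100Nθ = sym (trans
      (solve 3 (λ m e i → m :* (e :* i) := e :* (m :* i)) refl (fromℕ 100 * N) ε ((fromℕ 100 * N) ⁻¹))
      (trans (*-congˡ (inverseʳ (0<fromℕ*N 99))) (*-identityʳ ε)))

    ∣m-v∣≤θ : ∀ i → ∣ prob μ i - N ⁻¹ ∣ᵣ ≤ θ
    ∣m-v∣≤θ i = ≤-trans (∣f-g∣≤‖f-g‖∞ (prob μ) (uniform (suc n)) i) (proj₁ near)

    near-upper : ∀ i → fromℕ 100 * (N * prob μ i - 1#) ≤ ε
    near-upper i = certify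
      (solve 5 (λ e N m v t → e :- con (+ 100) :* (N :* m :- con (+ 1)) :=
         con (+ 100) :* N :* (t :- (m :- v)) :+ (:- con (+ 100)) :* (N :* v :- con (+ 1))
           :+ con (+ 1) :* (e :- con (+ 100) :* N :* t))
        refl ε N (prob μ i) (N ⁻¹) θ)
      (0≤fromℕ 100 ⟨*⟩ 0≤N ⟨*⟩ gap (≤-trans (x≤∣x∣ _) (∣m-v∣≤θ i))
        ⟨+⟩ vanish (- fromℕ 100) (inverseʳ (0<fromℕ n)) ⟨+⟩ vanish 1# ε≈100Nθ)

    near-lower : ∀ i → - ε ≤ fromℕ 100 * (N * prob μ i - 1#)
    near-lower i = certify
      (solve 5 (λ e N m v t → con (+ 100) :* (N :* m :- con (+ 1)) :- (:- e) :=
         con (+ 100) :* N :* (t :- (:- (m :- v))) :+ con (+ 100) :* (N :* v :- con (+ 1))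
           :+ con (+ 1) :* (e :- con (+ 100) :* N :* t))
        refl ε N (prob μ i) (N ⁻¹) θ)
      (0≤fromℕ 100 ⟨*⟩ 0≤N ⟨*⟩ gap (≤-trans (-x≤∣x∣ _) (∣m-v∣≤θ i))
        ⟨+⟩ vanish (fromℕ 100) (inverseʳ (0<fromℕ n)) ⟨+⟩ vanish 1# ε≈100Nθ)

    -- With m the probabilities under μ, both N m_i and N m_j are within ε/100
    -- of 1, so m_j / (m_i + m_j) exceeds 1/2 by at most ε/100.  The inequality is cleared of the denominator
    -- m_i + m_j by multiplying with 2 N (m_i + m_j).
    nearly-fair : ∀ {i j} → i ≢ j → fromℕ 100 * sampleProb μ (pair i j) j ≤ fromℕ 50 + ε
    nearly-fair {i} {j} i≢j = *-cancelˡ-≤ 0<2NS (certify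
      (solve 6 (λ N x y S Q e →
         con (+ 2) :* (N :* S) :* (con (+ 50) :+ e) :- con (+ 2) :* (N :* S) :* (con (+ 100) :* Q) :=
         (con (+ 100) :* (N :* x :- con (+ 1)) :- (:- e)) :+ (e :- con (+ 100) :* (N :* y :- con (+ 1)))
           :+ con (+ 2) :* e :* (N :* S :- con (+ 1))
           :+ con (+ 100) :* N :* (S :- (x :+ y)) :+ (:- (con (+ 200) :* N)) :* (Q :* S :- y))
        refl N (prob μ i) (prob μ j) S Q ε)
      (gap (near-lower i) ⟨+⟩ gap (near-upper j) ⟨+⟩ 0≤fromℕ 2 ⟨*⟩ 0≤ε ⟨*⟩ gap 1≤NS
        ⟨+⟩ vanish (fromℕ 100 * N) (mass-pair μ i≢j)
        ⟨+⟩ vanish (- (fromℕ 200 * N)) (sampleProb*mass μ (∈-pairʳ i j))))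
      where
      S = mass μ (pair i j)
      Q = sampleProb μ (pair i j) j

      1≤NS : 1# ≤ N * S
      1≤NS = *-cancelˡ-≤ (0<fromℕ 99) (certify
        (solve 5 (λ N x y S e → con (+ 100) :* (N :* S) :- con (+ 100) :* con (+ 1) :=
           (con (+ 100) :* (N :* x :- con (+ 1)) :- (:- e)) :+ (con (+ 100) :* (N :* y :- con (+ 1)) :- (:- e))
             :+ con (+ 2) :* (con (+ 1) :- e) :+ con (+ 98) :+ con (+ 100) :* N :* (S :- (x :+ y)))
          refl N (prob μ i) (prob μ j) S ε)
        (gap (near-lower i) ⟨+⟩ gap (near-lower j) ⟨+⟩ 0≤fromℕ 2 ⟨*⟩ gap (proj₁ ε<1) ⟨+⟩ 0≤fromℕ 98
          ⟨+⟩ vanish (fromℕ 100 * N) (mass-pair μ i≢j)))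

      0<2NS : 0# < fromℕ 2 * (N * S)
      0<2NS = 1≤⇒0< (certify
        (solve 1 (λ x → con (+ 2) :* x :- con (+ 1) := con (+ 2) :* (x :- con (+ 1)) :+ con (+ 1)) refl (N * S))
        (0≤fromℕ 2 ⟨*⟩ gap 1≤NS ⟨+⟩ 0≤1))

    module _ (ν : Distribution (suc n)) where

      p : Fin (suc n) → ℝ
      p = prob ν

      -- For i ≠ j put S = p_i + p_j and P = p_j / S.  Then
      -- p_j (P - 1/2) - (p_j - p_i) / 4 = S (2 P - 1)² / 4, which is nonnegative
      -- also when p_j < p_i.  For i = j the bias is nonnegative unless p_j = 0.
      bias-bound : ∀ i j → fromℕ 25 * (p j - p i) - ε * p j ≤ fromℕ 100 * (p j * bias ν i j)
      bias-bound i j with i ≟ j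
      ... | yes ≡.refl = certify
        (solve 4 (λ x P Q e →
           con (+ 100) :* (x :* (P :- Q)) :- (con (+ 25) :* (x :- x) :- e :* x) :=
           con (+ 100) :* x :* (con (+ 1) :- Q) :+ con (+ 100) :* (P :* x :- x) :+ e :* x)
          refl (p j) (sampleProb ν (pair j j) j) (sampleProb μ (pair j j) j) ε)
        (0≤fromℕ 100 ⟨*⟩ nonneg ν j ⟨*⟩ gap (sampleProb≤1 μ (pair j j) (pair-nonempty j j) j)
          ⟨+⟩ vanish (fromℕ 100) (trans (*-congˡ (sym (mass-pair-diagonal ν j)))
                (sampleProb*mass ν (∈-pairʳ j j)))
          ⟨+⟩ 0≤ε ⟨*⟩ nonneg ν j)
      ... | no i≢j = certify
        (solve 6 (λ x y S P Q e →
           con (+ 100) :* (y :* (P :- Q)) :- (con (+ 25) :* (y :- x) :- e :* y) :=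
           y :* (con (+ 50) :+ e :- con (+ 100) :* Q)
             :+ con (+ 25) :* S :* ((con (+ 2) :* P :- con (+ 1)) :* (con (+ 2) :* P :- con (+ 1)))
             :+ con (+ 100) :* (con (+ 1) :- P) :* (P :* S :- y) :+ (:- con (+ 25)) :* (S :- (x :+ y)))
          refl (p i) (p j) (mass ν (pair i j)) P (sampleProb μ (pair i j) j) ε)
        (nonneg ν j ⟨*⟩ gap (nearly-fair i≢j)
          ⟨+⟩ 0≤fromℕ 25 ⟨*⟩ mass-nonneg ν (pair i j) ⟨*⟩ square (fromℕ 2 * P - 1#)
          ⟨+⟩ vanish (fromℕ 100 * (1# - P)) (sampleProb*mass ν (∈-pairʳ i j))
          ⟨+⟩ vanish (- fromℕ 25) (mass-pair ν i≢j))
        where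
        P = sampleProb ν (pair i j) j

      pairScore≈mean : ∀ i → pairScore ν i ≈ mean p (λ j → bias ν i j * bias ν i j)
      pairScore≈mean i = sum-cong (λ j → *-congʳ {bias ν i j * bias ν i j} (sampleProb-⊤ ν j))

      pairScore-nonneg : ∀ i → 0# ≤ pairScore ν i
      pairScore-nonneg i = ≤-resp refl (sym (pairScore≈mean i))
        (sum-nonneg (λ j → nonneg ν j ⟨*⟩ square (bias ν i j)))

      -- The square (4 b - ε)² ≥ 0 bounds b² below by a linear function of the
      -- bias b; its slope, of order ε, is chosen to match the bias to be detected.
      pairScore-bound : ∀ i →
        fromℕ 50 * ε - fromℕ 27 * (ε * ε) - fromℕ 50 * ε * N * p i ≤ fromℕ 400 * pairScore ν i
      pairScore-bound i = begin
        a - fromℕ 50 * ε * N * p i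
          ≈⟨ solve 4 (λ a e N x → a :- con (+ 50) :* e :* N :* x :=
               a :* con (+ 1) :+ (:- (con (+ 50) :* e :* x)) :* (N :* con (+ 1))) refl a ε N (p i) ⟩
        a * 1# + b * (N * 1#)
          ≈⟨ +-cong (*-congˡ (total ν)) (*-congˡ (sum-const (suc n) 1#)) ⟨
        a * sum p + b * sum {suc n} (λ _ → 1#)
          ≈⟨ sum-linear a b p (λ _ → 1#) ⟨
        sum (λ j → a * p j + b * 1#)
          ≤⟨ sum-mono (λ j → certify (solve 4 (λ x y B e →
               con (+ 400) :* (y :* (B :* B)) :-
                 ((con (+ 50) :* e :- con (+ 27) :* (e :* e)) :* y :+ (:- (con (+ 50) :* e :* x)) :* con (+ 1)) :=
               con (+ 25) :* y :* ((con (+ 4) :* B :- e) :* (con (+ 4) :* B :- e))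
                 :+ con (+ 2) :* e :* (con (+ 100) :* (y :* B) :- (con (+ 25) :* (y :- x) :- e :* y)))
               refl (p i) (p j) (bias ν i j) ε)
               (0≤fromℕ 25 ⟨*⟩ nonneg ν j ⟨*⟩ square (fromℕ 4 * bias ν i j - ε)
                 ⟨+⟩ 0≤fromℕ 2 ⟨*⟩ 0≤ε ⟨*⟩ gap (bias-bound i j))) ⟩
        sum (λ j → fromℕ 400 * (p j * (bias ν i j * bias ν i j)))
          ≈⟨ sum-*ˡ (fromℕ 400) (λ j → p j * (bias ν i j * bias ν i j)) ⟩
        fromℕ 400 * mean p (λ j → bias ν i j * bias ν i j)
          ≈⟨ *-congˡ (pairScore≈mean i) ⟨
        fromℕ 400 * pairScore ν i ∎
        where
        a = fromℕ 50 * ε - fromℕ 27 * (ε * ε)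
        b = - (fromℕ 50 * ε * p i)

      -- Twice the positive part of the difference, written so that the total is
      -- visibly twice the variation distance.
      gain : Fin (suc n) → ℝ
      gain i = ∣ prob μ i - p i ∣ᵣ + (prob μ i - p i)

      -- Where p_i is at most μ_i this is the previous bound with N μ_i in place of 1;
      -- elsewhere the gain vanishes and nonnegativity of the pair score is enough.
      pairScore-gain : ∀ i →
        fromℕ 50 * ε * N * gain i + - (fromℕ 55 * (ε * ε)) * 1# ≤ fromℕ 800 * pairScore ν i
      pairScore-gain i with ⊔-sel (prob μ i - p i) (- (prob μ i - p i))
      ... | inj₁ ∣d∣≈d = certify
        (solve 6 (λ e N m x A F →
           con (+ 800) :* F :- (con (+ 50) :* e :* N :* (A :+ (m :- x)) :+ (:- (con (+ 55) :* (e :* e))) :* con (+ 1)) :=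
           con (+ 2) :* (con (+ 400) :* F :- (con (+ 50) :* e :- con (+ 27) :* (e :* e) :- con (+ 50) :* e :* N :* x))
             :+ e :* (e :- con (+ 100) :* (N :* m :- con (+ 1)))
             :+ con (+ 50) :* e :* N :* ((m :- x) :- A))
          refl ε N (prob μ i) (p i) ∣ prob μ i - p i ∣ᵣ (pairScore ν i))
        (0≤fromℕ 2 ⟨*⟩ gap (pairScore-bound i) ⟨+⟩ 0≤ε ⟨*⟩ gap (near-upper i)
          ⟨+⟩ vanish (fromℕ 50 * ε * N) (sym ∣d∣≈d))
      ... | inj₂ ∣d∣≈-d = certify
        (solve 6 (λ e N m x A F →
           con (+ 800) :* F :- (con (+ 50) :* e :* N :* (A :+ (m :- x)) :+ (:- (con (+ 55) :* (e :* e))) :* con (+ 1)) :=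
           con (+ 800) :* F :+ con (+ 55) :* (e :* e) :+ con (+ 50) :* e :* N :* ((:- (m :- x)) :- A))
          refl ε N (prob μ i) (p i) ∣ prob μ i - p i ∣ᵣ (pairScore ν i))
        (0≤fromℕ 800 ⟨*⟩ pairScore-nonneg i ⟨+⟩ 0≤fromℕ 55 ⟨*⟩ square ε
          ⟨+⟩ vanish (fromℕ 50 * ε * N) (sym ∣d∣≈-d))

      sum-gain : sum gain ≈ sum (λ i → ∣ prob μ i - p i ∣ᵣ)
      sum-gain = trans (sum-+ (λ i → ∣ prob μ i - p i ∣ᵣ) (λ i → prob μ i - p i))
        (trans (+-congˡ Σd≈0) (+-identityʳ _))
        where
        Σd≈0 : sum (λ i → prob μ i - p i) ≈ 0#
        Σd≈0 = begin-equality
          sum (λ i → prob μ i - p i)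
            ≈⟨ sum-cong (λ i → solve 2 (λ m x → m :- x := con (+ 1) :* m :+ (:- con (+ 1)) :* x) refl (prob μ i) (p i)) ⟩
          sum (λ i → 1# * prob μ i + - 1# * p i)
            ≈⟨ sum-linear 1# (- 1#) (prob μ) p ⟩
          1# * sum (prob μ) + - 1# * sum p
            ≈⟨ +-cong (*-congˡ (total μ)) (*-congˡ (total ν)) ⟩
          1# * 1# + - 1# * 1#
            ≈⟨ solve 0 (con (+ 1) :* con (+ 1) :+ (:- con (+ 1)) :* con (+ 1) := con (+ 0)) refl ⟩
          0# ∎

      -- Summing over i gives 800 Σ ≥ 100 ε² N - 55 ε² N for the sum Σ of the pair
      -- scores.  The coins lose a factor of at most 2, so the score is at least
      -- 9 ε² / 320, which is more than 4 s = ε² / 40.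
      score-far : ε ≤ variationDistance μ ν → ∀ s → fromℕ 160 * s ≈ ε * ε → fromℕ 4 * s ≤ score ν
      score-far ε≤d s 160s≈ε² = *-cancelˡ-≤ (0<fromℕ*N 1599) (certify
        (solve 6 (λ N s M F D e →
           con (+ 1600) :* N :* M :- con (+ 1600) :* N :* (con (+ 4) :* s) :=
           con (+ 800) :* (con (+ 2) :* N :* M :- F)
             :+ (con (+ 800) :* F :- (con (+ 50) :* e :* N :* D :+ (:- (con (+ 55) :* (e :* e))) :* (N :* con (+ 1))))
             :+ con (+ 50) :* e :* N :* (D :- con (+ 2) :* e)
             :+ con (+ 5) :* (e :* e) :* N :+ (:- (con (+ 40) :* N)) :* (con (+ 160) :* s :- e :* e))
          refl N s (score ν) (sum (pairScore ν)) D ε)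
        (0≤fromℕ 800 ⟨*⟩ gap (c-covering (pairScore ν) pairScore-nonneg)
          ⟨+⟩ gap total-gain
          ⟨+⟩ 0≤fromℕ 50 ⟨*⟩ 0≤ε ⟨*⟩ 0≤N ⟨*⟩ gap 2ε≤D
          ⟨+⟩ 0≤fromℕ 5 ⟨*⟩ square ε ⟨*⟩ 0≤N ⟨+⟩ vanish (- (fromℕ 40 * N)) 160s≈ε²))
        where
        D = sum (λ i → ∣ prob μ i - p i ∣ᵣ)

        2ε≤D : fromℕ 2 * ε ≤ D
        2ε≤D = certify
          (solve 3 (λ h D e → D :- con (+ 2) :* e :=
             con (+ 2) :* (h :* D :- e) :+ (:- D) :* (con (+ 2) :* h :- con (+ 1))) refl half D ε)
          (0≤fromℕ 2 ⟨*⟩ gap ε≤d ⟨+⟩ vanish (- D) 2*half≈1)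

        total-gain : fromℕ 50 * ε * N * D + - (fromℕ 55 * (ε * ε)) * (N * 1#) ≤ fromℕ 800 * sum (pairScore ν)
        total-gain = begin
          fromℕ 50 * ε * N * D + - (fromℕ 55 * (ε * ε)) * (N * 1#)
            ≈⟨ +-cong (*-congˡ sum-gain) (*-congˡ (sum-const (suc n) 1#)) ⟨
          fromℕ 50 * ε * N * sum gain + - (fromℕ 55 * (ε * ε)) * sum {suc n} (λ _ → 1#)
            ≈⟨ sum-linear (fromℕ 50 * ε * N) (- (fromℕ 55 * (ε * ε))) gain (λ _ → 1#) ⟨
          sum (λ i → fromℕ 50 * ε * N * gain i + - (fromℕ 55 * (ε * ε)) * 1#)
            ≤⟨ sum-mono pairScore-gain ⟩
          sum (λ i → fromℕ 800 * pairScore ν i)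
            ≈⟨ sum-*ˡ (fromℕ 800) (pairScore ν) ⟩
          fromℕ 800 * sum (pairScore ν) ∎

  -- Choice of the parameters

  module Parameters (ε δ : ℝ) (0<ε : 0# < ε) (ε<1 : ε < 1#) (0<δ : 0# < δ) (δ<1 : δ < 1#) where

    -- A quarter of the lower bound ε² / 40 for the score: this balances the
    -- expected growth s · score of the wealth against the loss 2 s².
    stake : ℝ
    stake = ε * ε ÷ fromℕ 160

    160*stake≈ε² : fromℕ 160 * stake ≈ ε * ε
    160*stake≈ε² = trans (solve 3 (λ k e i → k :* (e :* e :* i) := e :* e :* (k :* i)) refl (fromℕ 160) ε (fromℕ 160 ⁻¹))
      (trans (*-congˡ (inverseʳ (0<fromℕ 159))) (*-identityʳ _))

    0≤stake : 0# ≤ stake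
    0≤stake = square ε ⟨*⟩ 0≤⁻¹ (0<fromℕ 159)

    2*stake≤1 : fromℕ 2 * stake ≤ 1#
    2*stake≤1 = *-cancelˡ-≤ (0<fromℕ 159) (certify
      (solve 2 (λ e s → con (+ 160) :* con (+ 1) :- con (+ 160) :* (con (+ 2) :* s) :=
         con (+ 158) :+ con (+ 2) :* ((con (+ 1) :- e) :* (con (+ 1) :+ e))
           :+ (:- con (+ 2)) :* (con (+ 160) :* s :- e :* e)) refl ε stake)
      (0≤fromℕ 158 ⟨+⟩ 0≤fromℕ 2 ⟨*⟩ (gap (proj₁ ε<1) ⟨*⟩ (0≤1 ⟨+⟩ proj₁ 0<ε))
        ⟨+⟩ vanish (- fromℕ 2) 160*stake≈ε²))

    D : ℝ
    D = δ ⁻¹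

    0≤D : 0# ≤ D
    0≤D = 0≤⁻¹ 0<δ

    1≤D : 1# ≤ D
    1≤D = certify
      (solve 2 (λ d D → D :- con (+ 1) := D :* (con (+ 1) :- d) :+ con (+ 1) :* (d :* D :- con (+ 1))) refl δ D)
      (0≤D ⟨*⟩ gap (proj₁ δ<1) ⟨+⟩ vanish 1# (inverseʳ 0<δ))

    K X X⁴ : ℝ
    K = fromℕ 160 * fromℕ 160
    X = ε ⁻¹
    X⁴ = X * X * (X * X)

    0≤K*X⁴ : 0# ≤ K * X⁴
    0≤K*X⁴ = 0≤fromℕ 160 ⟨*⟩ 0≤fromℕ 160 ⟨*⟩ square (X * X)

    -- A block of trials at least halves the mean reciprocal of the wealth, and rounds
    -- many blocks bring it from 1 down to δ.
    block rounds : ℕ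
    block  = proj₁ (ceiling 0≤K*X⁴)
    rounds = proj₁ (log₂-ceiling 1≤D)

    rate : ℝ
    rate = 1# - fromℕ 2 * (stake * stake)

    K*X⁴*stake²≈1 : K * X⁴ * (stake * stake) ≈ 1#
    K*X⁴*stake²≈1 = begin-equality
      K * X⁴ * (stake * stake)
        ≈⟨ solve 3 (λ k s y → k :* k :* y :* (s :* s) := k :* s :* (k :* s) :* y) refl (fromℕ 160) stake X⁴ ⟩
      fromℕ 160 * stake * (fromℕ 160 * stake) * X⁴
        ≈⟨ *-congʳ (*-cong 160*stake≈ε² 160*stake≈ε²) ⟩
      ε * ε * (ε * ε) * X⁴
        ≈⟨ solve 2 (λ e x → e :* e :* (e :* e) :* (x :* x :* (x :* x)) := e :* x :* (e :* x) :* (e :* x :* (e :* x))) refl ε X ⟩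
      ε * X * (ε * X) * (ε * X * (ε * X))
        ≈⟨ *-cong εX*εX≈1 εX*εX≈1 ⟩
      1# * 1#
        ≈⟨ *-identityˡ 1# ⟩
      1# ∎
      where
      εX*εX≈1 : ε * X * (ε * X) ≈ 1#
      εX*εX≈1 = trans (*-cong (inverseʳ 0<ε) (inverseʳ 0<ε)) (*-identityˡ 1#)

    0≤rate : 0# ≤ rate
    0≤rate = 0≤1-2s² 0≤stake 2*stake≤1

    block-halves : fromℕ 2 * rate ^ block ≤ 1#
    block-halves = 2*[1-x]^k≤1 block (0≤fromℕ 2 ⟨*⟩ square stake)
      (certify refl 0≤rate)
      (certify (solve 3 (λ b k s → b :* (con (+ 2) :* (s :* s)) :- con (+ 1) :=
          con (+ 2) :* (b :- k) :* (s :* s) :+ con (+ 2) :* (k :* (s :* s) :- con (+ 1)) :+ con (+ 1))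
          refl (fromℕ block) (K * X⁴) stake)
        (0≤fromℕ 2 ⟨*⟩ gap (proj₁ (proj₂ (ceiling 0≤K*X⁴))) ⟨*⟩ square stake
          ⟨+⟩ vanish (fromℕ 2) K*X⁴*stake²≈1 ⟨+⟩ 0≤1))

    -- The mean reciprocal has to reach δ², hence twice the number of rounds.
    trials : ℕ
    trials = block ℕ.* (rounds ℕ.+ rounds)

    trials-suffice : D * rate ^ trials * 1# ≤ δ
    trials-suffice = begin
      D * rate ^ trials * 1#  ≈⟨ *-identityʳ _ ⟩
      D * rate ^ trials       ≈⟨ *-congˡ (trans (sym (^-assocʳ rate block (rounds ℕ.+ rounds)))
                                                (^-homo-* (rate ^ block) rounds rounds)) ⟩
      D * (e * e)             ≤⟨ certify (solve 3 (λ d D e → d :- D :* (e :* e) :=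
                                   e :* (con (+ 1) :- D :* e) :+ d :* (con (+ 1) :- D :* e) :+ e :* (d :* D :- con (+ 1)))
                                   refl δ D e)
                                   (0≤e ⟨*⟩ gap De≤1 ⟨+⟩ proj₁ 0<δ ⟨*⟩ gap De≤1 ⟨+⟩ vanish e (inverseʳ 0<δ)) ⟩
      δ                       ∎
      where
      e = (rate ^ block) ^ rounds

      0≤e : 0# ≤ e
      0≤e = 0≤^ rounds (0≤^ block 0≤rate)

      De≤1 : D * e ≤ 1#
      De≤1 = begin
        D * e                                 ≤⟨ *-mono-≤ (≤-trans (≤-trans 0≤1 1≤D) D≤2^k) 0≤e D≤2^k ≤-refl ⟩
        fromℕ 2 ^ rounds * e                  ≈⟨ ^-distrib-* (fromℕ 2) (rate ^ block) rounds ⟨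
        (fromℕ 2 * rate ^ block) ^ rounds     ≤⟨ ^-monoˡ-≤ rounds (0≤fromℕ 2 ⟨*⟩ 0≤^ block 0≤rate) block-halves ⟩
        1# ^ rounds                           ≈⟨ 1^k≈1 rounds ⟩
        1#                                    ∎
        where
        D≤2^k = proj₁ (proj₂ (log₂-ceiling 1≤D))

  -- The expansion of 6 (160² X⁴ + 1) (Y + 1): three samples in each of the
  -- 2 · block · rounds trials.
  sampleBound : Polynomial₂
  sampleBound = (fromℕ 6 ∷ fromℕ 6 ∷ []) ∷ [] ∷ [] ∷ [] ∷ (c ∷ c ∷ []) ∷ []
    where
    c = fromℕ 6 * (fromℕ 160 * fromℕ 160)

  samples-bound : ∀ ε δ 0<ε ε<1 0<δ δ<1 →
    fromℕ (Parameters.trials ε δ 0<ε ε<1 0<δ δ<1 ℕ.* 3) ≤ eval₂ sampleBound (ε ⁻¹) (log₂ (δ ⁻¹))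
  samples-bound ε δ 0<ε ε<1 0<δ δ<1 = begin
    fromℕ (trials ℕ.* 3)
      ≈⟨ trans (fromℕ-* trials 3) (*-congʳ (trans (fromℕ-* block (rounds ℕ.+ rounds)) (*-congˡ (fromℕ-+ rounds rounds)))) ⟩
    fromℕ block * (fromℕ rounds + fromℕ rounds) * fromℕ 3
      ≈⟨ solve 2 (λ b r → b :* (r :+ r) :* con (+ 3) := con (+ 6) :* (b :* r)) refl (fromℕ block) (fromℕ rounds) ⟩
    fromℕ 6 * (fromℕ block * fromℕ rounds)
      ≤⟨ *-monoˡ-≤ (0≤fromℕ 6) (*-mono-≤ (0≤K*X⁴ ⟨+⟩ 0≤1) (0≤fromℕ rounds)
           (proj₂ (proj₂ (ceiling 0≤K*X⁴))) (proj₂ (proj₂ (log₂-ceiling 1≤D)))) ⟩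
    fromℕ 6 * ((K * X⁴ + 1#) * (log₂ D + 1#))
      ≈⟨ solve 4 (λ h k x y →
           h :* ((k :* (x :* x :* (x :* x)) :+ con (+ 1)) :* (y :+ con (+ 1))) :=
           (h :+ y :* (h :+ y :* con (+ 0))) :+ x :* (con (+ 0) :+ x :* (con (+ 0) :+ x :* (con (+ 0) :+ x :*
             ((h :* k :+ y :* (h :* k :+ y :* con (+ 0))) :+ x :* con (+ 0))))))
           refl (fromℕ 6) K X (log₂ D) ⟩
    eval₂ sampleBound X (log₂ D) ∎
    where
    open Parameters ε δ 0<ε ε<1 0<δ δ<1

  tester : ∀ ε δ → 0# < ε → ε < 1# → 0# < δ → δ < 1# → ∀ n (μ : Distribution n) →
    ‖ prob μ - uniform n ‖∞ < ε ÷ (fromℕ 100 * fromℕ n) →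
    ∃[ q ] (fromℕ q ≤ eval₂ sampleBound (ε ⁻¹) (log₂ (δ ⁻¹)) ×
      Σ[ T ∈ Algorithm n q ] TestsIdentity ε δ μ T)
  tester ε δ 0<ε ε<1 0<δ δ<1 zero    μ near = ⊥-elim (0≉1 (total μ))
  tester ε δ 0<ε ε<1 0<δ δ<1 (suc n) μ near =
    trials ℕ.* 3 , samples-bound ε δ 0<ε ε<1 0<δ δ<1 , T , λ μ′ →
      ( λ μ′≋μ → 1-≤Pr-accept T μ′ (≤-trans
          (Pr-reject-null μ′ δ (proj₁ 0<δ) (≤-reflexive (sym (inverseʳ 0<δ))) (score-null {μ′} μ′≋μ) trials 1# 0≤1)
          (≤-reflexive (*-identityʳ δ))))
    , ( λ ε≤d → 1-≤Pr-reject T μ′ (≤-trans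
          (Pr-accept-far μ′ (score-far μ′ ε≤d stake 160*stake≈ε²) trials 1# 1# 0≤1 (≤-reflexive (sym (*-identityˡ 1#))))
          trials-suffice))
    where
    open Parameters ε δ 0<ε ε<1 0<δ δ<1
    c          = proj₁ (coins-covering n)
    open Tester μ zero c
    open Betting stake D 0≤stake 2*stake≤1 0≤D
    open Separation μ c (proj₂ (coins-covering n)) ε 0<ε ε<1 near using (score-far)
    T          = run trials 1#

theorem3p1p2 : (R : CompleteOrderedField) →
    let open Testing R in
    Σ[ p ∈ Polynomial₂ ]
    (∀ (ε δ : ℝ) → 0# < ε → ε < 1# → 0# < δ → δ < 1# →
    ∀ (n : ℕ) (μ : Distribution n) →
    ‖ prob μ - uniform n ‖∞ < ε ÷ (fromℕ 100 * fromℕ n) →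
    ∃[ q ] (fromℕ q ≤ eval₂ p (ε ⁻¹) (log₂ (δ ⁻¹)) ×
    Σ[ T ∈ Algorithm n q ] TestsIdentity ε δ μ T))
theorem3p1p2 R = sampleBound , tester
  where open IdentityTesting R
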